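{- Let $G_1$ and $G_2$ be vertex-disjoint graphs on $n_1$ and $n_2$ vertices respectively. Then, as identities of rational functions in $x$: (a) $$f_{A(G_1\underset{=}{\vee}G_2)}(x)=x^{n_1}\,f_{A(G_2)}(x)\,\det\!\Big(xI_{n_1}-A(G_1)-\tfrac1x A^2(\overline{G_1})\Big)\Big[1-\Gamma_{A(G_2)}(x)\,\Gamma_{A(G_1)+\frac1x A^2(\overline{G_1})}(x)\Big].$$ (b) $$f_{A(G_1\veebar G_2)}(x)=x^{n_1}\,f_{A(G_2)}(x)\,\det\!\Big(xI_{n_1}-A(G_1)-\tfrac1x A^2(G_1)\Big)\Big[1-\Gamma_{A(G_2)}(x)\,\Gamma_{A(G_1)+\frac1x A^2(G_1)}(x)\Big].$$
   Context: Graphs are finite, undirected and simple. $A(G)$ is the adjacency matrix of $G$, $\overline{G}$ is the complement of $G$, and $A^2(G)=(A(G))^2$. For an $n\times n$ matrix $M$, $f_M(x)=\det(xI_n-M)$, and the coronal of $M$ is $\Gamma_M(x)=\mathbf 1_n^T(xI_n-M)^{ -1}\mathbf 1_n$, where $\mathbf 1_n$ is the all-ones column. When the entries of $M$ themselves depend on $x$, $\Gamma_M(x)$ means $\mathbf 1_n^T(xI_n-M)^{ -1}\mathbf 1_n$ with that same $x$. Let $V(G_1)=\{u_1,\dots,u_{n_1}\}$. The join $G_1\vee G_2$ is the disjoint union of $G_1$ and $G_2$ together with all edges between $V(G_1)$ and $V(G_2)$. The NS (Neighbors Splitting) join $G_1\veebar G_2$ is obtained from $G_1\vee G_2$ by adding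 new vertices $u_1',\dots,u_{n_1}'$ and joining $u_i'$ to $u_j$ if and only if $u_iu_j\in E(G_1)$. The NNS (Non Neighbors Splitting) join $G_1\underset{=}{\vee}G_2$ is obtained from $G_1\vee G_2$ by adding new vertices $u_1',\dots,u_{n_1}'$ and joining $u_i'$ to $u_j$ if and only if $i\ne j$ and $u_iu_j\notin E(G_1)$. -}

module Defs where

open import Algebra.Bundles using (CommutativeRing)
import Algebra.Properties.CommutativeSemigroup
import Algebra.Properties.Monoid.Sum
import Algebra.Properties.Ring
import Algebra.Properties.Semiring.Exp
import Algebra.Solver.Ring.NaturalCoefficients.Default
open import Data.Bool.Base using (if_then_else_)
open import Data.Empty using (⊥)
open import Data.Fin.Base using (Fin; zero; suc; punchIn; splitAt; toℕ)
import Data.Fin.Properties as Fin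
open import Data.List.Base using (List; []; _∷_; map)
open import Data.Nat.Base using (ℕ; zero; suc)
import Data.Nat.Base as ℕ
open import Data.Product.Base using (_×_; _,_)
open import Data.Rational using (ℚ; 0ℚ; 1ℚ)
import Data.Rational as ℚ
import Data.Rational.Properties as ℚ
open import Data.Sum.Base using (_⊎_; inj₁; inj₂; map₁; [_,_]′)
open import Data.Unit.Base using (⊤; tt)
open import Function.Base using (_∘_; flip)
open import Level using (0ℓ; _⊔_)
open import Relation.Binary.Core using (Rel; REL)
open import Relation.Binary.Definitions using (Decidable; Symmetric)
open import Relation.Binary.PropositionalEquality
  using (_≡_; _≢_; refl; sym; trans; cong; cong₂; module ≡-Reasoning)
import Relation.Binary.Reasoning.Setoid
open import Relation.Nullary.Decidable using (does; yes; no; ¬?; _×-dec_)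
open import Relation.Nullary.Negation using (¬_; contradiction)

record Graph (V : Set) : Set₁ where
  field
    Adj       : Rel V 0ℓ
    adj?      : Decidable Adj
    symmetric : Symmetric Adj
    loopless  : ∀ v → ¬ Adj v v

open Graph public using (Adj; adj?)

pullback : {V W : Set} → (W → V) → Graph V → Graph W
pullback f G = record
  { Adj       = λ v w → Adj G (f v) (f w)
  ; adj?      = λ v w → adj? G (f v) (f w)
  ; symmetric = Graph.symmetric G
  ; loopless  = λ v → Graph.loopless G (f v)
  }

complement : ∀ {n} → Graph (Fin n) → Graph (Fin n)
complement G = record
  { Adj       = λ i j → i ≢ j × ¬ Adj G i j
  ; adj?      = λ i j → ¬? (i Fin.≟ j) ×-dec ¬? (adj? G i j)
  ; symmetric = λ { (i≢j , i≁j) → (i≢j ∘ sym) , (i≁j ∘ Graph.symmetric G) }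
  ; loopless  = λ { i (i≢i , _) → i≢i refl }
  }

join : {V W : Set} → Graph V → Graph W → Graph (V ⊎ W)
join {V} {W} G H = record
  { Adj = _~_ ; adj? = _~?_ ; symmetric = λ {x} {y} → ~-sym x y ; loopless = ~-irr }
  where
  _~_ : Rel (V ⊎ W) 0ℓ
  inj₁ v ~ inj₁ v′ = Adj G v v′
  inj₁ _ ~ inj₂ _  = ⊤
  inj₂ _ ~ inj₁ _  = ⊤
  inj₂ w ~ inj₂ w′ = Adj H w w′

  _~?_ : Decidable _~_
  inj₁ v ~? inj₁ v′ = adj? G v v′
  inj₁ _ ~? inj₂ _  = yes tt
  inj₂ _ ~? inj₁ _  = yes tt
  inj₂ w ~? inj₂ w′ = adj? H w w′

  ~-sym : ∀ x y → x ~ y → y ~ x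
  ~-sym (inj₁ _) (inj₁ _) = Graph.symmetric G
  ~-sym (inj₁ _) (inj₂ _) = λ _ → tt
  ~-sym (inj₂ _) (inj₁ _) = λ _ → tt
  ~-sym (inj₂ _) (inj₂ _) = Graph.symmetric H

  ~-irr : ∀ x → ¬ (x ~ x)
  ~-irr (inj₁ v) = Graph.loopless G v
  ~-irr (inj₂ w) = Graph.loopless H w

-- G together with a new independent vertex inj₂ u for every u : U, where
-- inj₂ u is joined to the old vertex v exactly when R u v.
addVertices : {V U : Set} → Graph V → (R : REL U V 0ℓ) → Decidable R →
              Graph (V ⊎ U)
addVertices {V} {U} G R R? = record
  { Adj = _~_ ; adj? = _~?_ ; symmetric = λ {x} {y} → ~-sym x y ; loopless = ~-irr }
  where
  _~_ : Rel (V ⊎ U) 0ℓ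
  inj₁ v ~ inj₁ v′ = Adj G v v′
  inj₁ v ~ inj₂ u  = R u v
  inj₂ u ~ inj₁ v  = R u v
  inj₂ _ ~ inj₂ _  = ⊥

  _~?_ : Decidable _~_
  inj₁ v ~? inj₁ v′ = adj? G v v′
  inj₁ v ~? inj₂ u  = R? u v
  inj₂ u ~? inj₁ v  = R? u v
  inj₂ _ ~? inj₂ _  = no λ ()

  ~-sym : ∀ x y → x ~ y → y ~ x
  ~-sym (inj₁ _) (inj₁ _) = Graph.symmetric G
  ~-sym (inj₁ _) (inj₂ _) = λ r → r
  ~-sym (inj₂ _) (inj₁ _) = λ r → r
  ~-sym (inj₂ _) (inj₂ _) = λ ()

  ~-irr : ∀ x → ¬ (x ~ x)
  ~-irr (inj₁ v) = Graph.loopless G v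
  ~-irr (inj₂ _) = λ ()

-- The new vertex u_i′ is joined to u_j exactly when S i j, and to no vertex
-- of G₂.
splittingJoin : ∀ {n₁ n₂} → Graph (Fin n₁) → Graph (Fin n₂) →
                (S : Rel (Fin n₁) 0ℓ) → Decidable S →
                Graph ((Fin n₁ ⊎ Fin n₂) ⊎ Fin n₁)
splittingJoin {n₁} {n₂} G₁ G₂ S S? = addVertices (join G₁ G₂) R R?
  where
  R : REL (Fin n₁) (Fin n₁ ⊎ Fin n₂) 0ℓ
  R i (inj₁ j) = S i j
  R i (inj₂ _) = ⊥

  R? : Decidable R
  R? i (inj₁ j) = S? i j
  R? i (inj₂ _) = no λ ()

-- Vertices are listed in the order V(G₁), V(G₂), new vertices.
numbering : ∀ n₁ n₂ → Fin ((n₁ ℕ.+ n₂) ℕ.+ n₁) → (Fin n₁ ⊎ Fin n₂) ⊎ Fin n₁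
numbering n₁ n₂ = map₁ (splitAt n₁) ∘ splitAt (n₁ ℕ.+ n₂)

NSJoin : ∀ {n₁ n₂} → Graph (Fin n₁) → Graph (Fin n₂) →
         Graph (Fin ((n₁ ℕ.+ n₂) ℕ.+ n₁))
NSJoin {n₁} {n₂} G₁ G₂ =
  pullback (numbering n₁ n₂) (splittingJoin G₁ G₂ (Adj G₁) (adj? G₁))

NNSJoin : ∀ {n₁ n₂} → Graph (Fin n₁) → Graph (Fin n₂) →
          Graph (Fin ((n₁ ℕ.+ n₂) ℕ.+ n₁))
NNSJoin {n₁} {n₂} G₁ G₂ =
  pullback (numbering n₁ n₂)
    (splittingJoin G₁ G₂ (λ i j → i ≢ j × ¬ Adj G₁ i j)
                         (λ i j → ¬? (i Fin.≟ j) ×-dec ¬? (adj? G₁ i j)))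

module Matrices {c ℓ} (R : CommutativeRing c ℓ) where

  open CommutativeRing R hiding (zero; refl; sym; trans)
  open Algebra.Properties.Monoid.Sum +-monoid using (sum)
  open Algebra.Properties.Semiring.Exp semiring using (_^_)

  infix  4 _≈ᴹ_
  infixl 6 _+ᴹ_ _-ᴹ_
  infixl 7 _*ᴹ_
  infixr 8 _·ᴹ_

  Matrix : ℕ → ℕ → Set c
  Matrix m n = Fin m → Fin n → Carrier

  _≈ᴹ_ : ∀ {m n} → Rel (Matrix m n) ℓ
  M ≈ᴹ N = ∀ i j → M i j ≈ N i j

  _+ᴹ_ _-ᴹ_ : ∀ {m n} → Matrix m n → Matrix m n → Matrix m n
  (M +ᴹ N) i j = M i j + N i j
  (M -ᴹ N) i j = M i j - N i j

  _·ᴹ_ : ∀ {m n} → Carrier → Matrix m n → Matrix m n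
  (a ·ᴹ M) i j = a * M i j

  _*ᴹ_ : ∀ {m n p} → Matrix m n → Matrix n p → Matrix m p
  (M *ᴹ N) i k = sum λ j → M i j * N j k

  Iᴹ : ∀ n → Matrix n n
  Iᴹ n i j = if does (i Fin.≟ j) then 1# else 0#

  -- Laplace expansion along the first row.
  det : ∀ {n} → Matrix n n → Carrier
  det {zero}  M = 1#
  det {suc n} M = sum λ j →
    (- 1#) ^ toℕ j * M zero j * det (λ i k → M (suc i) (punchIn j k))

  record Inverse {n} (M : Matrix n n) : Set (c ⊔ ℓ) where
    field
      inv      : Matrix n n
      inverseˡ : inv *ᴹ M ≈ᴹ Iᴹ n
      inverseʳ : M *ᴹ inv ≈ᴹ Iᴹ n

  open Inverse public

  adjacency : ∀ {n} → Graph (Fin n) → Matrix n n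
  adjacency G i j = if does (adj? G i j) then 1# else 0#

  𝟙 : ∀ n → Matrix n 1
  𝟙 n _ _ = 1#

  𝟙ᵀ : ∀ n → Matrix 1 n
  𝟙ᵀ n _ _ = 1#

  -- The intended use is R = ℚ(x) with x the indeterminate, so that the entries
  -- of M may themselves depend on x. Two inverses of a matrix agree, so the
  -- value of coronal does not depend on its last argument.

  charMatrix : ∀ {n} → Carrier → Matrix n n → Matrix n n
  charMatrix {n} x M = x ·ᴹ Iᴹ n -ᴹ M

  charPoly : ∀ {n} → Carrier → Matrix n n → Carrier
  charPoly x M = det (charMatrix x M)

  coronal : ∀ {n} (x : Carrier) (M : Matrix n n) →
            Inverse (charMatrix x M) → Carrier
  coronal {n} x M B = (𝟙ᵀ n *ᴹ inv B *ᴹ 𝟙 n) zero zero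

-- Lists of coefficients, constant term first; trailing zeros are allowed
-- and are disregarded by _≈ₚ_.
Poly : Set
Poly = List ℚ

coeff : Poly → ℕ → ℚ
coeff []      _       = 0ℚ
coeff (a ∷ p) zero    = a
coeff (a ∷ p) (suc n) = coeff p n

infix 4 _≈ₚ_

record _≈ₚ_ (p q : Poly) : Set where
  constructor mk≈
  field coeff≡ : ∀ n → coeff p n ≡ coeff q n

open _≈ₚ_ public

infixl 6 _+ₚ_
infixl 7 _*ₚ_
infixr 8 _·ₚ_
infix  9 -ₚ_

_+ₚ_ : Poly → Poly → Poly
[]      +ₚ q       = q
(a ∷ p) +ₚ []      = a ∷ p
(a ∷ p) +ₚ (b ∷ q) = a ℚ.+ b ∷ p +ₚ q

-ₚ_ : Poly → Poly
-ₚ_ = map λ a → ℚ.- a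

_·ₚ_ : ℚ → Poly → Poly
a ·ₚ p = map (a ℚ.*_) p

_*ₚ_ : Poly → Poly → Poly
[]      *ₚ q = []
(a ∷ p) *ₚ q = a ·ₚ q +ₚ (0ℚ ∷ p *ₚ q)

0ₚ 1ₚ xₚ : Poly
0ₚ = []
1ₚ = 1ℚ ∷ []
xₚ = 0ℚ ∷ 1ℚ ∷ []

module PolyProperties where

  open CommutativeRing ℚ.+-*-commutativeRing using ()
    renaming (ring to ℚ-ring; +-commutativeSemigroup to ℚ-+-commutativeSemigroup)
  open Algebra.Properties.Ring ℚ-ring using (-0#≈0#)

  ≈-refl : ∀ {p} → p ≈ₚ p
  ≈-refl = mk≈ λ _ → refl

  ≈-sym : ∀ {p q} → p ≈ₚ q → q ≈ₚ p
  ≈-sym (mk≈ e) = mk≈ λ n → sym (e n)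

  ≈-trans : ∀ {p q r} → p ≈ₚ q → q ≈ₚ r → p ≈ₚ r
  ≈-trans (mk≈ e) (mk≈ f) = mk≈ λ n → trans (e n) (f n)

  coeff-+ : ∀ p q n → coeff (p +ₚ q) n ≡ coeff p n ℚ.+ coeff q n
  coeff-+ []      q       n       = sym (ℚ.+-identityˡ _)
  coeff-+ (a ∷ p) []      n       = sym (ℚ.+-identityʳ _)
  coeff-+ (a ∷ p) (b ∷ q) zero    = refl
  coeff-+ (a ∷ p) (b ∷ q) (suc n) = coeff-+ p q n

  coeff-neg : ∀ p n → coeff (-ₚ p) n ≡ ℚ.- coeff p n
  coeff-neg []      n       = sym -0#≈0#
  coeff-neg (a ∷ p) zero    = refl
  coeff-neg (a ∷ p) (suc n) = coeff-neg p n

  coeff-· : ∀ a p n → coeff (a ·ₚ p) n ≡ a ℚ.* coeff p n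
  coeff-· a []      n       = sym (ℚ.*-zeroʳ a)
  coeff-· a (b ∷ p) zero    = refl
  coeff-· a (b ∷ p) (suc n) = coeff-· a p n

  ∷-cong : ∀ {a b p q} → a ≡ b → p ≈ₚ q → a ∷ p ≈ₚ b ∷ q
  ∷-cong a≡b (mk≈ e) = mk≈ λ { zero → a≡b ; (suc n) → e n }

  0∷[] : 0ℚ ∷ [] ≈ₚ []
  0∷[] = mk≈ λ { zero → refl ; (suc _) → refl }

  +-cong : ∀ {p p′ q q′} → p ≈ₚ p′ → q ≈ₚ q′ → p +ₚ q ≈ₚ p′ +ₚ q′
  +-cong {p} {p′} {q} {q′} (mk≈ e) (mk≈ f) = mk≈ λ n →
    trans (coeff-+ p q n)
      (trans (cong₂ ℚ._+_ (e n) (f n)) (sym (coeff-+ p′ q′ n)))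

  +-comm : ∀ p q → p +ₚ q ≈ₚ q +ₚ p
  +-comm p q = mk≈ λ n →
    trans (coeff-+ p q n)
      (trans (ℚ.+-comm (coeff p n) (coeff q n)) (sym (coeff-+ q p n)))

  +-assoc : ∀ p q r → (p +ₚ q) +ₚ r ≈ₚ p +ₚ (q +ₚ r)
  +-assoc p q r = mk≈ λ n → begin
    coeff ((p +ₚ q) +ₚ r) n                    ≡⟨ coeff-+ (p +ₚ q) r n ⟩
    coeff (p +ₚ q) n ℚ.+ coeff r n             ≡⟨ cong (ℚ._+ coeff r n) (coeff-+ p q n) ⟩
    (coeff p n ℚ.+ coeff q n) ℚ.+ coeff r n    ≡⟨ ℚ.+-assoc (coeff p n) (coeff q n) (coeff r n) ⟩
    coeff p n ℚ.+ (coeff q n ℚ.+ coeff r n)    ≡⟨ cong (coeff p n ℚ.+_) (coeff-+ q r n) ⟨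
    coeff p n ℚ.+ coeff (q +ₚ r) n             ≡⟨ coeff-+ p (q +ₚ r) n ⟨
    coeff (p +ₚ (q +ₚ r)) n                    ∎
    where open ≡-Reasoning

  +-identityʳ : ∀ p → p +ₚ [] ≈ₚ p
  +-identityʳ []      = ≈-refl
  +-identityʳ (a ∷ p) = ≈-refl

  neg-cong : ∀ {p q} → p ≈ₚ q → -ₚ p ≈ₚ -ₚ q
  neg-cong {p} {q} (mk≈ e) = mk≈ λ n →
    trans (coeff-neg p n) (trans (cong (λ a → ℚ.- a) (e n)) (sym (coeff-neg q n)))

  neg-inverseˡ : ∀ p → (-ₚ p) +ₚ p ≈ₚ []
  neg-inverseˡ p = mk≈ λ n → trans (coeff-+ (-ₚ p) p n)
    (trans (cong (ℚ._+ coeff p n) (coeff-neg p n)) (ℚ.+-inverseˡ (coeff p n)))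

  ·-cong : ∀ {a b p q} → a ≡ b → p ≈ₚ q → a ·ₚ p ≈ₚ b ·ₚ q
  ·-cong {a} {b} {p} {q} a≡b (mk≈ e) = mk≈ λ n →
    trans (coeff-· a p n) (trans (cong₂ ℚ._*_ a≡b (e n)) (sym (coeff-· b q n)))

  ·-distribˡ : ∀ a p q → a ·ₚ (p +ₚ q) ≈ₚ a ·ₚ p +ₚ a ·ₚ q
  ·-distribˡ a p q = mk≈ λ n → begin
    coeff (a ·ₚ (p +ₚ q)) n                        ≡⟨ coeff-· a (p +ₚ q) n ⟩
    a ℚ.* coeff (p +ₚ q) n                         ≡⟨ cong (a ℚ.*_) (coeff-+ p q n) ⟩
    a ℚ.* (coeff p n ℚ.+ coeff q n)                ≡⟨ ℚ.*-distribˡ-+ a (coeff p n) (coeff q n) ⟩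
    a ℚ.* coeff p n ℚ.+ a ℚ.* coeff q n            ≡⟨ cong₂ ℚ._+_ (coeff-· a p n) (coeff-· a q n) ⟨
    coeff (a ·ₚ p) n ℚ.+ coeff (a ·ₚ q) n          ≡⟨ coeff-+ (a ·ₚ p) (a ·ₚ q) n ⟨
    coeff (a ·ₚ p +ₚ a ·ₚ q) n                     ∎
    where open ≡-Reasoning

  ·-distribʳ : ∀ a b p → (a ℚ.+ b) ·ₚ p ≈ₚ a ·ₚ p +ₚ b ·ₚ p
  ·-distribʳ a b p = mk≈ λ n → begin
    coeff ((a ℚ.+ b) ·ₚ p) n                       ≡⟨ coeff-· (a ℚ.+ b) p n ⟩
    (a ℚ.+ b) ℚ.* coeff p n                        ≡⟨ ℚ.*-distribʳ-+ (coeff p n) a b ⟩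
    a ℚ.* coeff p n ℚ.+ b ℚ.* coeff p n            ≡⟨ cong₂ ℚ._+_ (coeff-· a p n) (coeff-· b p n) ⟨
    coeff (a ·ₚ p) n ℚ.+ coeff (b ·ₚ p) n          ≡⟨ coeff-+ (a ·ₚ p) (b ·ₚ p) n ⟨
    coeff (a ·ₚ p +ₚ b ·ₚ p) n                     ∎
    where open ≡-Reasoning

  ·-assoc : ∀ a b p → (a ℚ.* b) ·ₚ p ≈ₚ a ·ₚ b ·ₚ p
  ·-assoc a b p = mk≈ λ n → begin
    coeff ((a ℚ.* b) ·ₚ p) n    ≡⟨ coeff-· (a ℚ.* b) p n ⟩
    (a ℚ.* b) ℚ.* coeff p n     ≡⟨ ℚ.*-assoc a b (coeff p n) ⟩
    a ℚ.* (b ℚ.* coeff p n)     ≡⟨ cong (a ℚ.*_) (coeff-· b p n) ⟨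
    a ℚ.* coeff (b ·ₚ p) n      ≡⟨ coeff-· a (b ·ₚ p) n ⟨
    coeff (a ·ₚ b ·ₚ p) n       ∎
    where open ≡-Reasoning

  0·-zero : ∀ p → 0ℚ ·ₚ p ≈ₚ []
  0·-zero p = mk≈ λ n → trans (coeff-· 0ℚ p n) (ℚ.*-zeroˡ (coeff p n))

  1·-identity : ∀ p → 1ℚ ·ₚ p ≈ₚ p
  1·-identity p = mk≈ λ n → trans (coeff-· 1ℚ p n) (ℚ.*-identityˡ (coeff p n))

  +-interchange : ∀ p q r s → (p +ₚ q) +ₚ (r +ₚ s) ≈ₚ (p +ₚ r) +ₚ (q +ₚ s)
  +-interchange p q r s = mk≈ λ n → begin
    coeff ((p +ₚ q) +ₚ (r +ₚ s)) n
      ≡⟨ split p q r s n ⟩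
    (coeff p n ℚ.+ coeff q n) ℚ.+ (coeff r n ℚ.+ coeff s n)
      ≡⟨ interchange (coeff p n) (coeff q n) (coeff r n) (coeff s n) ⟩
    (coeff p n ℚ.+ coeff r n) ℚ.+ (coeff q n ℚ.+ coeff s n)
      ≡⟨ split p r q s n ⟨
    coeff ((p +ₚ r) +ₚ (q +ₚ s)) n ∎
    where
    open ≡-Reasoning
    open Algebra.Properties.CommutativeSemigroup ℚ-+-commutativeSemigroup
      using (interchange)

    split : ∀ p q r s n → coeff ((p +ₚ q) +ₚ (r +ₚ s)) n ≡
            (coeff p n ℚ.+ coeff q n) ℚ.+ (coeff r n ℚ.+ coeff s n)
    split p q r s n = trans (coeff-+ (p +ₚ q) (r +ₚ s) n)
      (cong₂ ℚ._+_ (coeff-+ p q n) (coeff-+ r s n))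

  *-congʳ : ∀ p {q r} → q ≈ₚ r → p *ₚ q ≈ₚ p *ₚ r
  *-congʳ []      q≈r = ≈-refl
  *-congʳ (a ∷ p) q≈r =
    +-cong (·-cong (refl {x = a}) q≈r) (∷-cong refl (*-congʳ p q≈r))

  *-zeroʳ : ∀ p → p *ₚ [] ≈ₚ []
  *-zeroʳ []      = ≈-refl
  *-zeroʳ (a ∷ p) = ≈-trans (∷-cong refl (*-zeroʳ p)) 0∷[]

  *-∷ : ∀ p b q → p *ₚ (b ∷ q) ≈ₚ b ·ₚ p +ₚ (0ℚ ∷ p *ₚ q)
  *-∷ []      b q = ≈-sym 0∷[]
  *-∷ (a ∷ p) b q = ∷-cong (cong (ℚ._+ 0ℚ) (ℚ.*-comm a b))
    (≈-trans (+-cong ≈-refl (*-∷ p b q))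
      (≈-trans (≈-sym (+-assoc (a ·ₚ q) (b ·ₚ p) _))
        (≈-trans (+-cong (+-comm (a ·ₚ q) (b ·ₚ p)) ≈-refl)
          (+-assoc (b ·ₚ p) (a ·ₚ q) _))))

  *-comm : ∀ p q → p *ₚ q ≈ₚ q *ₚ p
  *-comm []      q = ≈-sym (*-zeroʳ q)
  *-comm (a ∷ p) q = ≈-trans (+-cong ≈-refl (∷-cong refl (*-comm p q)))
    (≈-sym (*-∷ q a p))

  *-cong : ∀ {p p′ q q′} → p ≈ₚ p′ → q ≈ₚ q′ → p *ₚ q ≈ₚ p′ *ₚ q′
  *-cong {p} {p′} {q} {q′} p≈ q≈ = ≈-trans (*-congʳ p q≈)
    (≈-trans (*-comm p q′) (≈-trans (*-congʳ q′ p≈) (*-comm q′ p′)))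

  *-distribʳ : ∀ r p q → (p +ₚ q) *ₚ r ≈ₚ p *ₚ r +ₚ q *ₚ r
  *-distribʳ r []      q       = ≈-refl
  *-distribʳ r (a ∷ p) []      = ≈-sym (+-identityʳ _)
  *-distribʳ r (a ∷ p) (b ∷ q) =
    ≈-trans (+-cong (·-distribʳ a b r)
              (∷-cong (sym (ℚ.+-identityˡ 0ℚ)) (*-distribʳ r p q)))
      (+-interchange (a ·ₚ r) (b ·ₚ r) (0ℚ ∷ p *ₚ r) (0ℚ ∷ q *ₚ r))

  ·-*-assoc : ∀ a p q → (a ·ₚ p) *ₚ q ≈ₚ a ·ₚ (p *ₚ q)
  ·-*-assoc a []      q = ≈-refl
  ·-*-assoc a (b ∷ p) q =
    ≈-trans (+-cong (·-assoc a b q)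
              (∷-cong (sym (ℚ.*-zeroʳ a)) (·-*-assoc a p q)))
      (≈-sym (·-distribˡ a (b ·ₚ q) (0ℚ ∷ p *ₚ q)))

  0∷-* : ∀ p q → (0ℚ ∷ p) *ₚ q ≈ₚ 0ℚ ∷ p *ₚ q
  0∷-* p q = +-cong (0·-zero q) ≈-refl

  *-assoc : ∀ p q r → (p *ₚ q) *ₚ r ≈ₚ p *ₚ (q *ₚ r)
  *-assoc []      q r = ≈-refl
  *-assoc (a ∷ p) q r =
    ≈-trans (*-distribʳ r (a ·ₚ q) (0ℚ ∷ p *ₚ q))
      (+-cong (·-*-assoc a q r)
        (≈-trans (0∷-* (p *ₚ q) r) (∷-cong refl (*-assoc p q r))))

  *-identityˡ : ∀ p → 1ₚ *ₚ p ≈ₚ p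
  *-identityˡ p = ≈-trans (+-cong (1·-identity p) 0∷[]) (+-identityʳ p)

  *-distribˡ : ∀ r p q → r *ₚ (p +ₚ q) ≈ₚ r *ₚ p +ₚ r *ₚ q
  *-distribˡ r p q = ≈-trans (*-comm r (p +ₚ q))
    (≈-trans (*-distribʳ r p q) (+-cong (*-comm p r) (*-comm q r)))

  ℚ-noZeroDivisors : ∀ a b → a ≢ 0ℚ → a ℚ.* b ≡ 0ℚ → b ≡ 0ℚ
  ℚ-noZeroDivisors a b a≢0 ab≡0 = begin
    b                              ≡⟨ ℚ.*-identityˡ b ⟨
    1ℚ ℚ.* b                       ≡⟨ cong (ℚ._* b) (ℚ.*-inverseˡ a) ⟨
    (ℚ.1/ a) ℚ.* a ℚ.* b           ≡⟨ ℚ.*-assoc (ℚ.1/ a) a b ⟩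
    (ℚ.1/ a) ℚ.* (a ℚ.* b)         ≡⟨ cong ((ℚ.1/ a) ℚ.*_) ab≡0 ⟩
    (ℚ.1/ a) ℚ.* 0ℚ                ≡⟨ ℚ.*-zeroʳ (ℚ.1/ a) ⟩
    0ℚ                             ∎
    where
    open ≡-Reasoning
    instance _ = ℚ.≢-nonZero a≢0

  0∷≈0⇒≈0 : ∀ {p} → 0ℚ ∷ p ≈ₚ [] → p ≈ₚ []
  0∷≈0⇒≈0 (mk≈ e) = mk≈ λ n → e (suc n)

  private
    nonzeroConstant : ∀ a p q → a ≢ 0ℚ → (a ∷ p) *ₚ q ≈ₚ [] → q ≈ₚ []
    nonzeroConstant a p []      a≢0 pq≈0 = ≈-refl
    nonzeroConstant a p (b ∷ q) a≢0 pq≈0 =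
      ≈-trans (∷-cong b≡0 (nonzeroConstant a p q a≢0 (0∷≈0⇒≈0 shifted))) 0∷[]
      where
      b≡0 : b ≡ 0ℚ
      b≡0 = ℚ-noZeroDivisors a b a≢0
        (trans (sym (ℚ.+-identityʳ (a ℚ.* b))) (coeff≡ pq≈0 0))

      shifted : 0ℚ ∷ (a ∷ p) *ₚ q ≈ₚ []
      shifted = ≈-trans
        (+-cong (≈-sym (≈-trans (·-cong {p = a ∷ p} b≡0 ≈-refl) (0·-zero (a ∷ p))))
                ≈-refl)
        (≈-trans (≈-sym (*-∷ (a ∷ p) b q)) pq≈0)

  noZeroDivisors : ∀ p q → p *ₚ q ≈ₚ [] → p ≈ₚ [] ⊎ q ≈ₚ []
  noZeroDivisors []      q pq≈0 = inj₁ ≈-refl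
  noZeroDivisors (a ∷ p) q pq≈0 with a ℚ.≟ 0ℚ
  ... | no a≢0   = inj₂ (nonzeroConstant a p q a≢0 pq≈0)
  ... | yes refl = map₁ (λ p≈0 → ≈-trans (∷-cong refl p≈0) 0∷[])
      (noZeroDivisors p q (0∷≈0⇒≈0 (≈-trans (≈-sym (0∷-* p q)) pq≈0)))

  1≉0 : ¬ 1ₚ ≈ₚ 0ₚ
  1≉0 (mk≈ e) = ℚ.1≢0 (e 0)

  x≉0 : ¬ xₚ ≈ₚ 0ₚ
  x≉0 (mk≈ e) = ℚ.1≢0 (e 1)

ℚ[x] : CommutativeRing 0ℓ 0ℓ
ℚ[x] = record
  { Carrier = Poly ; _≈_ = _≈ₚ_ ; _+_ = _+ₚ_ ; _*_ = _*ₚ_ ; -_ = -ₚ_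
  ; 0# = 0ₚ ; 1# = 1ₚ
  ; isCommutativeRing = record
    { isRing = record
      { +-isAbelianGroup = record
        { isGroup = record
          { isMonoid = record
            { isSemigroup = record
              { isMagma = record
                { isEquivalence = record
                  { refl = ≈-refl ; sym = ≈-sym ; trans = ≈-trans }
                ; ∙-cong = +-cong }
              ; assoc = +-assoc }
            ; identity = (λ _ → ≈-refl) , +-identityʳ }
          ; inverse = neg-inverseˡ
                    , λ p → ≈-trans (+-comm p (-ₚ p)) (neg-inverseˡ p)
          ; ⁻¹-cong = neg-cong }
        ; comm = +-comm }
      ; *-cong = *-cong
      ; *-assoc = *-assoc
      ; *-identity = *-identityˡ
                   , λ p → ≈-trans (*-comm p 1ₚ) (*-identityˡ p)
      ; distrib = *-distribˡ , *-distribʳ }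
    ; *-comm = *-comm } }
  where open PolyProperties

module Fractions {c ℓ} (D : CommutativeRing c ℓ)
  (1≉0 : ¬ CommutativeRing._≈_ D (CommutativeRing.1# D) (CommutativeRing.0# D))
  (noZeroDivisors : ∀ a b →
    CommutativeRing._≈_ D (CommutativeRing._*_ D a b) (CommutativeRing.0# D) →
    CommutativeRing._≈_ D a (CommutativeRing.0# D) ⊎
    CommutativeRing._≈_ D b (CommutativeRing.0# D))
  where

  open CommutativeRing D
    renaming (refl to ≈-refl; sym to ≈-sym; trans to ≈-trans)
  open Algebra.Properties.Ring ring using (-‿distribˡ-*; x∙y⁻¹≈ε⇒x≈y)
  open Relation.Binary.Reasoning.Setoid setoid
  open Algebra.Solver.Ring.NaturalCoefficients.Default commutativeSemiring
    using (solve) renaming (_:=_ to _⊜_; _:+_ to _⊕_; _:*_ to _⊗_)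

  record Fraction : Set (c ⊔ ℓ) where
    constructor frac
    field
      num   : Carrier
      den   : Carrier
      den≉0 : ¬ den ≈ 0#

  open Fraction public

  infix 4 _≃_

  record _≃_ (p q : Fraction) : Set ℓ where
    constructor mk≃
    field cross : num p * den q ≈ num q * den p

  *-nonzero : ∀ {a b} → ¬ a ≈ 0# → ¬ b ≈ 0# → ¬ a * b ≈ 0#
  *-nonzero {a} {b} a≉0 b≉0 ab≈0 = [ a≉0 , b≉0 ]′ (noZeroDivisors a b ab≈0)

  *-cancelʳ : ∀ {d a b} → ¬ d ≈ 0# → a * d ≈ b * d → a ≈ b
  *-cancelʳ {d} {a} {b} d≉0 ad≈bd =
    [ x∙y⁻¹≈ε⇒x≈y a b , flip contradiction d≉0 ]′ (noZeroDivisors (a - b) d (begin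
      (a - b) * d        ≈⟨ distribʳ d a (- b) ⟩
      a * d + - b * d    ≈⟨ +-cong ad≈bd (≈-sym (-‿distribˡ-* b d)) ⟩
      b * d - b * d      ≈⟨ -‿inverseʳ (b * d) ⟩
      0#                 ∎))

  embed : Carrier → Fraction
  embed a = frac a 1# 1≉0

  infixl 6 _⊞_
  infixl 7 _⊠_

  _⊞_ _⊠_ : Fraction → Fraction → Fraction
  frac a b b≉0 ⊞ frac c d d≉0 = frac (a * d + c * b) (b * d) (*-nonzero b≉0 d≉0)
  frac a b b≉0 ⊠ frac c d d≉0 = frac (a * c) (b * d) (*-nonzero b≉0 d≉0)

  ⊟_ : Fraction → Fraction
  ⊟ frac a b b≉0 = frac (- a) b b≉0

  private
    ≃-refl : ∀ {p} → p ≃ p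
    ≃-refl = mk≃ ≈-refl

    ≃-sym : ∀ {p q} → p ≃ q → q ≃ p
    ≃-sym (mk≃ e) = mk≃ (≈-sym e)

    ≃-trans : ∀ {p q r} → p ≃ q → q ≃ r → p ≃ r
    ≃-trans {frac a b _} {frac c d d≉0} {frac e f _} (mk≃ ad≈cb) (mk≃ cf≈ed) =
      mk≃ (*-cancelʳ d≉0 (begin
        a * f * d    ≈⟨ solve 3 (λ a f d → a ⊗ f ⊗ d ⊜ a ⊗ d ⊗ f) ≈-refl a f d ⟩
        a * d * f    ≈⟨ *-congʳ ad≈cb ⟩
        c * b * f    ≈⟨ solve 3 (λ c b f → c ⊗ b ⊗ f ⊜ c ⊗ f ⊗ b) ≈-refl c b f ⟩
        c * f * b    ≈⟨ *-congʳ cf≈ed ⟩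
        e * d * b    ≈⟨ solve 3 (λ e d b → e ⊗ d ⊗ b ⊜ e ⊗ b ⊗ d) ≈-refl e d b ⟩
        e * b * d    ∎))

    ⊞-cong : ∀ {p p′ q q′} → p ≃ p′ → q ≃ q′ → p ⊞ q ≃ p′ ⊞ q′
    ⊞-cong {frac a b _} {frac a′ b′ _} {frac c d _} {frac c′ d′ _}
           (mk≃ e) (mk≃ f) = mk≃ (begin
      (a * d + c * b) * (b′ * d′)
        ≈⟨ solve 6 (λ a b c d b′ d′ → (a ⊗ d ⊕ c ⊗ b) ⊗ (b′ ⊗ d′)
             ⊜ a ⊗ b′ ⊗ (d ⊗ d′) ⊕ c ⊗ d′ ⊗ (b ⊗ b′)) ≈-refl a b c d b′ d′ ⟩
      a * b′ * (d * d′) + c * d′ * (b * b′)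
        ≈⟨ +-cong (*-congʳ e) (*-congʳ f) ⟩
      a′ * b * (d * d′) + c′ * d * (b * b′)
        ≈⟨ solve 6 (λ a′ b c′ d b′ d′ → a′ ⊗ b ⊗ (d ⊗ d′) ⊕ c′ ⊗ d ⊗ (b ⊗ b′)
             ⊜ (a′ ⊗ d′ ⊕ c′ ⊗ b′) ⊗ (b ⊗ d)) ≈-refl a′ b c′ d b′ d′ ⟩
      (a′ * d′ + c′ * b′) * (b * d) ∎)

    ⊠-cong : ∀ {p p′ q q′} → p ≃ p′ → q ≃ q′ → p ⊠ q ≃ p′ ⊠ q′
    ⊠-cong {frac a b _} {frac a′ b′ _} {frac c d _} {frac c′ d′ _}
           (mk≃ e) (mk≃ f) = mk≃ (begin
      a * c * (b′ * d′)
        ≈⟨ solve 4 (λ a c b′ d′ → a ⊗ c ⊗ (b′ ⊗ d′) ⊜ a ⊗ b′ ⊗ (c ⊗ d′))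
             ≈-refl a c b′ d′ ⟩
      a * b′ * (c * d′)
        ≈⟨ *-cong e f ⟩
      a′ * b * (c′ * d)
        ≈⟨ solve 4 (λ a′ b c′ d → a′ ⊗ b ⊗ (c′ ⊗ d) ⊜ a′ ⊗ c′ ⊗ (b ⊗ d))
             ≈-refl a′ b c′ d ⟩
      a′ * c′ * (b * d) ∎)

    ⊟-cong : ∀ {p q} → p ≃ q → ⊟ p ≃ ⊟ q
    ⊟-cong {frac a b _} {frac c d _} (mk≃ e) = mk≃ (begin
      - a * d      ≈⟨ -‿distribˡ-* a d ⟨
      - (a * d)    ≈⟨ -‿cong e ⟩
      - (c * b)    ≈⟨ -‿distribˡ-* c b ⟩
      - c * b      ∎)

    ⊞-comm : ∀ p q → p ⊞ q ≃ q ⊞ p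
    ⊞-comm (frac a b _) (frac c d _) = mk≃
      (solve 4 (λ a b c d → (a ⊗ d ⊕ c ⊗ b) ⊗ (d ⊗ b) ⊜ (c ⊗ b ⊕ a ⊗ d) ⊗ (b ⊗ d))
        ≈-refl a b c d)

    ⊞-assoc : ∀ p q r → (p ⊞ q) ⊞ r ≃ p ⊞ (q ⊞ r)
    ⊞-assoc (frac a b _) (frac c d _) (frac e f _) = mk≃
      (solve 6 (λ a b c d e f →
        ((a ⊗ d ⊕ c ⊗ b) ⊗ f ⊕ e ⊗ (b ⊗ d)) ⊗ (b ⊗ (d ⊗ f)) ⊜
        (a ⊗ (d ⊗ f) ⊕ (c ⊗ f ⊕ e ⊗ d) ⊗ b) ⊗ (b ⊗ d ⊗ f)) ≈-refl a b c d e f)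

    ⊞-identityˡ : ∀ p → embed 0# ⊞ p ≃ p
    ⊞-identityˡ (frac a b _) = mk≃ (begin
      (0# * b + a * 1#) * b    ≈⟨ *-congʳ (+-cong (zeroˡ b) (*-identityʳ a)) ⟩
      (0# + a) * b             ≈⟨ *-cong (+-identityˡ a) (≈-sym (*-identityˡ b)) ⟩
      a * (1# * b)             ∎)

    ⊟-inverseˡ : ∀ p → (⊟ p) ⊞ p ≃ embed 0#
    ⊟-inverseˡ (frac a b _) = mk≃ (begin
      (- a * b + a * b) * 1#    ≈⟨ *-identityʳ _ ⟩
      - a * b + a * b           ≈⟨ distribʳ b (- a) a ⟨
      (- a + a) * b             ≈⟨ *-congʳ (-‿inverseˡ a) ⟩
      0# * b                    ≈⟨ zeroˡ b ⟩
      0#                        ≈⟨ zeroˡ (b * b) ⟨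
      0# * (b * b)              ∎)

    ⊠-comm : ∀ p q → p ⊠ q ≃ q ⊠ p
    ⊠-comm (frac a b _) (frac c d _) = mk≃ (*-cong (*-comm a c) (*-comm d b))

    ⊠-assoc : ∀ p q r → (p ⊠ q) ⊠ r ≃ p ⊠ (q ⊠ r)
    ⊠-assoc (frac a b _) (frac c d _) (frac e f _) =
      mk≃ (*-cong (*-assoc a c e) (≈-sym (*-assoc b d f)))

    ⊠-identityˡ : ∀ p → embed 1# ⊠ p ≃ p
    ⊠-identityˡ (frac a b _) =
      mk≃ (*-cong (*-identityˡ a) (≈-sym (*-identityˡ b)))

    ⊠-distribʳ : ∀ r p q → (p ⊞ q) ⊠ r ≃ (p ⊠ r) ⊞ (q ⊠ r)
    ⊠-distribʳ (frac e f _) (frac a b _) (frac c d _) = mk≃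
      (solve 6 (λ a b c d e f →
        (a ⊗ d ⊕ c ⊗ b) ⊗ e ⊗ (b ⊗ f ⊗ (d ⊗ f)) ⊜
        (a ⊗ e ⊗ (d ⊗ f) ⊕ c ⊗ e ⊗ (b ⊗ f)) ⊗ (b ⊗ d ⊗ f)) ≈-refl a b c d e f)

  fractionField : CommutativeRing (c ⊔ ℓ) ℓ
  fractionField = record
    { Carrier = Fraction ; _≈_ = _≃_ ; _+_ = _⊞_ ; _*_ = _⊠_ ; -_ = ⊟_
    ; 0# = embed 0# ; 1# = embed 1#
    ; isCommutativeRing = record
      { isRing = record
        { +-isAbelianGroup = record
          { isGroup = record
            { isMonoid = record
              { isSemigroup = record
                { isMagma = record
                  { isEquivalence = record
                    { refl = ≃-refl ; sym = ≃-sym ; trans = ≃-trans }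
                  ; ∙-cong = ⊞-cong }
                ; assoc = ⊞-assoc }
              ; identity = ⊞-identityˡ
                         , λ p → ≃-trans (⊞-comm p (embed 0#)) (⊞-identityˡ p) }
            ; inverse = ⊟-inverseˡ
                      , λ p → ≃-trans (⊞-comm p (⊟ p)) (⊟-inverseˡ p)
            ; ⁻¹-cong = ⊟-cong }
          ; comm = ⊞-comm }
        ; *-cong = ⊠-cong
        ; *-assoc = ⊠-assoc
        ; *-identity = ⊠-identityˡ
                     , λ p → ≃-trans (⊠-comm p (embed 1#)) (⊠-identityˡ p)
        ; distrib = (λ r p q → ≃-trans (⊠-comm r (p ⊞ q))
                       (≃-trans (⊠-distribʳ r p q)
                         (⊞-cong (⊠-comm p r) (⊠-comm q r))))
                  , ⊠-distribʳ }
      ; *-comm = ⊠-comm } }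

-- Adjacency matrices have entries 0 and 1, so every rational function built
-- from them and x lies in ℚ(x); identities there persist over any larger
-- field of coefficients.
open Fractions ℚ[x] PolyProperties.1≉0 PolyProperties.noZeroDivisors public
  using (Fraction; frac; num; den; den≉0; _≃_; mk≃; embed)
  renaming (fractionField to ℚ⟨x⟩)

𝑥 1/𝑥 : Fraction
𝑥   = embed xₚ
1/𝑥 = frac 1ₚ xₚ PolyProperties.x≉0

module ℚ⟨x⟩ = CommutativeRing ℚ⟨x⟩

𝑥*1/𝑥≈1 : 𝑥 ℚ⟨x⟩.* 1/𝑥 ℚ⟨x⟩.≈ ℚ⟨x⟩.1#
𝑥*1/𝑥≈1 = mk≃ (mk≈ λ n → refl)

open ℚ⟨x⟩ public using () renaming (_*_ to _*ᶠ_; _-_ to _-ᶠ_; _≈_ to _≈ᶠ_; 1# to 1ᶠ)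
open Algebra.Properties.Semiring.Exp ℚ⟨x⟩.semiring public using () renaming (_^_ to _^ᶠ_)
open Matrices ℚ⟨x⟩ public

{-# OPTIONS --safe #-}

-- Order the vertices as V(G₁), V(G₂), new vertices, and let H be the graph on
-- V(G₁) whose edges govern the new vertices (G₁ itself, or its complement).
-- Adding x⁻¹ A(H) times the rows of the new vertices to those of V(G₁) clears
-- the last block column, which leaves xⁿ¹ times the determinant of
-- (X -J ; -Jᵀ xI - A(G₂)) with X = xI - A(G₁) - x⁻¹ A(H)². Clearing -J in the
-- same way by means of 𝟙ᵀ (xI - A(G₂))⁻¹ turns X into X - Γ₂ 𝟙𝟙ᵀ, a rank one
-- perturbation with determinant (1 - Γ₂ 𝟙ᵀ X⁻¹ 𝟙) det X.
--
-- For the inverses, write xI - M = x (I - x⁻¹ M). Here x⁻¹ M has entries in the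
-- ring 𝔪 of rational functions p / w with deg p < deg w. This is the maximal
-- ideal of the local ring at infinity, so that 1 - m is a unit for m in 𝔪 and
-- Gaussian elimination on I - x⁻¹ M never meets a bad pivot.
module Submission where

open import Algebra.Bundles using (CommutativeRing)
import Algebra.Properties.AbelianGroup
import Algebra.Properties.Group
import Algebra.Properties.Ring
import Algebra.Properties.Semiring.Exp
import Algebra.Properties.Semiring.Sum
import Algebra.Solver.Ring.NaturalCoefficients.Default
open import Data.Bool.Base using (true; false; if_then_else_)
open import Data.Fin.Base using (Fin; zero; suc; punchIn; splitAt; toℕ; lift; _↑ˡ_; _↑ʳ_)
import Data.Fin.Properties as Fin
import Data.List.Base as List
open import Data.List.Properties using (length-map)
open import Data.Nat.Base using (ℕ; zero; suc; _≤_; z≤n; s≤s)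
import Data.Nat.Base as ℕ
import Data.Nat.Properties as ℕ
open import Data.Product.Base using (_×_; _,_; Σ-syntax; ∃-syntax; proj₁; proj₂)
open import Data.Rational using (0ℚ; 1ℚ)
import Data.Rational as ℚ
import Data.Rational.Properties as ℚ
open import Data.Sum.Base using (_⊎_; inj₁; inj₂; [_,_]′; map₁)
open import Data.Unit.Polymorphic.Base using (⊤; tt)
open import Data.Vec.Functional as Vector using (Vector)
open import Defs using
  (Graph; Adj; adj?; pullback; splittingJoin; numbering; module Matrices;
   Poly; coeff; _≈ₚ_; coeff≡; _+ₚ_; _*ₚ_; -ₚ_; _·ₚ_; 0ₚ; 1ₚ; xₚ; ℚ[x];
   module PolyProperties; module Fractions; ℚ⟨x⟩; 1/𝑥)
open import Function.Base using (_∘_; const; flip)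
open import Function.Bundles using (mk⇔)
open import Level using (_⊔_)
open import Relation.Binary.PropositionalEquality using (_≡_; _≗_; cong)
import Relation.Binary.PropositionalEquality as ≡
import Relation.Binary.Reasoning.Setoid
open import Relation.Nullary.Decidable using (does; does-⇔)
open import Relation.Nullary.Negation using (¬_)
open import Relation.Unary using (Pred)

-- Determinants over a commutative ring, by expansion along the first row.

module Determinants {c ℓ} (R : CommutativeRing c ℓ) where

  open CommutativeRing R hiding (zero)
  open Matrices R
  open Vector using (_∷_)
  open Algebra.Properties.Group +-group
    using (inverseˡ-unique) renaming (⁻¹-involutive to -‿involutive)
  open Algebra.Properties.Ring ring using (-‿distribˡ-*; -1*x≈-x; -0#≈0#)
  open Algebra.Properties.Semiring.Exp semiring using (_^_)
  open Algebra.Properties.Semiring.Sum semiring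
    using (sum; ∑-comm; ∑-distrib-+; sum-cong-≋; sum-replicate-zero;
           *-distribˡ-sum; *-distribʳ-sum; sum-syntax)
  open Algebra.Solver.Ring.NaturalCoefficients.Default commutativeSemiring
    using (solve) renaming (_:=_ to _⊜_; _:+_ to _⊕_; _:*_ to _⊗_)
  open Relation.Binary.Reasoning.Setoid setoid

  sum-≈0 : ∀ {n} {f : Vector Carrier n} → (∀ i → f i ≈ 0#) → sum f ≈ 0#
  sum-≈0 {n} {f} f≈0 = trans (sum-cong-≋ {n} {f} {λ _ → 0#} f≈0) (sum-replicate-zero n)

  sum-split : ∀ m {p} (f : Vector Carrier (m ℕ.+ p)) →
              sum f ≈ ∑[ i < m ] f (i ↑ˡ p) + ∑[ k < p ] f (m ↑ʳ k)
  sum-split zero    f = sym (+-identityˡ _)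
  sum-split (suc m) f = trans (+-congˡ (sum-split m (f ∘ suc))) (sym (+-assoc _ _ _))

  sign : ∀ {n} → Fin n → Carrier
  sign j = (- 1#) ^ toℕ j

  minor : ∀ {m n} → Fin (suc n) → Matrix m (suc n) → Matrix m n
  minor j M i k = M i (punchIn j k)

  laplace : ∀ {n} → Vector Carrier (suc n) → Matrix n (suc n) → Vector Carrier (suc n)
  laplace r M j = sign j * r j * det (minor j M)

  det-cong : ∀ {n} {M N : Matrix n n} → M ≈ᴹ N → det M ≈ det N
  det-cong {zero}  M≈N = refl
  det-cong {suc n} {M} {N} M≈N =
    sum-cong-≋ {suc n} {laplace (M zero) (M ∘ suc)} {laplace (N zero) (N ∘ suc)} λ j →
      *-cong (*-congˡ (M≈N zero j)) (det-cong λ i k → M≈N (suc i) (punchIn j k))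

  det-congFirstRow : ∀ {n} {r s : Vector Carrier (suc n)} (M : Matrix n (suc n)) →
                     (∀ j → r j ≈ s j) → det (r ∷ M) ≈ det (s ∷ M)
  det-congFirstRow {r = r} {s} M r≈s =
    sum-cong-≋ {x = laplace r M} {laplace s M} λ j → *-congʳ (*-congˡ (r≈s j))

  -- Rows are functions, so a matrix and its reassembly from rows agree only pointwise. The
  -- rewriting exposes the two leading rows on which `det-swap` and `det-repeat` act.
  det-η : ∀ {n} (r : Vector Carrier (suc (suc n))) (M : Matrix (suc n) (suc (suc n))) →
          det (r ∷ M) ≈ det (r ∷ M zero ∷ (M ∘ suc))
  det-η r M = det-cong {M = r ∷ M} {r ∷ M zero ∷ (M ∘ suc)} λ
    { zero _ → refl ; (suc zero) _ → refl ; (suc (suc i)) _ → refl }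

  det-minor-∷ : ∀ {n} (j : Fin (suc (suc n))) (r : Vector Carrier (suc (suc n))) (M : Matrix n (suc (suc n))) →
                det (minor j (r ∷ M)) ≈ det ((r ∘ punchIn j) ∷ minor j M)
  det-minor-∷ j r M = det-cong {M = minor j (r ∷ M)} {(r ∘ punchIn j) ∷ minor j M} λ
    { zero _ → refl ; (suc i) _ → refl }

  det-congMinors : ∀ {n} (r : Vector Carrier (suc n)) {M N : Matrix n (suc n)} →
                   (∀ j → det (minor j M) ≈ det (minor j N)) → det (r ∷ M) ≈ det (r ∷ N)
  det-congMinors r {M} {N} M~N =
    sum-cong-≋ {x = laplace r M} {laplace r N} λ j → *-congˡ (M~N j)

  det-+ : ∀ {n} (r s : Vector Carrier (suc n)) (M : Matrix n (suc n)) →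
          det ((λ j → r j + s j) ∷ M) ≈ det (r ∷ M) + det (s ∷ M)
  det-+ r s M = trans
    (sum-cong-≋ {x = laplace (λ j → r j + s j) M} {λ j → laplace r M j + laplace s M j} λ j →
      solve 4 (λ e a b d → e ⊗ (a ⊕ b) ⊗ d ⊜ e ⊗ a ⊗ d ⊕ e ⊗ b ⊗ d)
        refl (sign j) (r j) (s j) (det (minor j M)))
    (∑-distrib-+ (laplace r M) (laplace s M))

  det-combination : ∀ {n p} (a : Vector Carrier p) (S : Matrix p (suc n)) (M : Matrix n (suc n)) →
                    det ((λ j → ∑[ k < p ] (a k * S k j)) ∷ M) ≈ ∑[ k < p ] (a k * det (S k ∷ M))
  det-combination {n} {p} a S M = begin
    ∑[ j < suc n ] (sign j * (∑[ k < p ] (a k * S k j)) * d j)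
      ≈⟨ sum-cong-≋ distribute ⟩
    ∑[ j < suc n ] ∑[ k < p ] (a k * laplace (S k) M j)
      ≈⟨ ∑-comm (λ j k → a k * laplace (S k) M j) ⟩
    ∑[ k < p ] ∑[ j < suc n ] (a k * laplace (S k) M j)
      ≈⟨ sum-cong-≋ (λ k → *-distribˡ-sum (a k) (laplace (S k) M)) ⟨
    ∑[ k < p ] (a k * det (S k ∷ M)) ∎
    where
    d : Fin (suc n) → Carrier
    d j = det (minor j M)

    distribute : ∀ j → sign j * (∑[ k < p ] (a k * S k j)) * d j ≈
                       ∑[ k < p ] (a k * laplace (S k) M j)
    distribute j = begin
      sign j * (∑[ k < p ] (a k * S k j)) * d j
        ≈⟨ *-congʳ (*-distribˡ-sum (sign j) (λ k → a k * S k j)) ⟩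
      (∑[ k < p ] (sign j * (a k * S k j))) * d j
        ≈⟨ *-distribʳ-sum (d j) (λ k → sign j * (a k * S k j)) ⟩
      ∑[ k < p ] (sign j * (a k * S k j) * d j)
        ≈⟨ sum-cong-≋ (λ k →
             solve 4 (λ e b s d → e ⊗ (b ⊗ s) ⊗ d ⊜ b ⊗ (e ⊗ s ⊗ d)) refl (sign j) (a k) (S k j) (d j)) ⟩
      ∑[ k < p ] (a k * laplace (S k) M j) ∎

  -- Alternation and row operations.

  -- A pair (j , k) stands for the ordered pair of distinct columns
  -- (j , punchIn j k), and Exchangeable says that f is invariant under
  -- exchanging the two columns, an exchange which flips sign j * sign k.
  signedSum : ∀ {n} → (Fin (suc n) → Fin n → Carrier) → Carrier
  signedSum {n} f = ∑[ j < suc n ] ∑[ k < n ] (sign j * sign k * f j k)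

  Exchangeable : ∀ n → (Fin (suc n) → Fin n → Carrier) → Set ℓ
  Exchangeable zero    f = ⊤
  Exchangeable (suc n) f =
    (∀ k → f zero k ≈ f (suc k) zero) × Exchangeable n (λ j k → f (suc j) (suc k))

  -- Terms cancel in twos: (0 , k) and (k + 1 , 0) name the same two columns, and their signs differ
  -- by one factor -1. The pairs avoiding column 0 form the same sum with one column fewer, because
  -- the two factors -1 gained there cancel. Cancelling term by term, instead of deriving 2 det = 0
  -- from an exchange of rows, works in every characteristic.
  exchangeable⇒signedSum≈0 : ∀ n f → Exchangeable n f → signedSum f ≈ 0#
  exchangeable⇒signedSum≈0 zero    f _              = +-identityˡ 0#
  exchangeable⇒signedSum≈0 (suc n) f (eq , ex) = begin
    sum first + ∑[ j < suc n ] (second j + sum (rest j))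
      ≈⟨ +-congˡ (∑-distrib-+ second (sum ∘ rest)) ⟩
    sum first + (sum second + sum (sum ∘ rest))
      ≈⟨ +-assoc _ _ _ ⟨
    sum first + sum second + sum (sum ∘ rest)
      ≈⟨ +-cong (trans (sym (∑-distrib-+ first second)) (sum-≈0 cancel))
                (sum-cong-≋ {suc n} λ j → sum-cong-≋ {x = rest j} λ k →
                  flip² (sign j) (sign k) (f (suc j) (suc k))) ⟩
    0# + signedSum (λ j k → f (suc j) (suc k))
      ≈⟨ trans (+-identityˡ _) (exchangeable⇒signedSum≈0 n (λ j k → f (suc j) (suc k)) ex) ⟩
    0# ∎
    where
    first second : Fin (suc n) → Carrier
    first  k = 1# * sign k * f zero k
    second j = sign (suc j) * 1# * f (suc j) zero

    rest : Fin (suc n) → Fin n → Carrier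
    rest j k = sign (suc j) * sign (suc k) * f (suc j) (suc k)

    cancel : ∀ k → first k + second k ≈ 0#
    cancel k = begin
      1# * sign k * f zero k + - 1# * sign k * 1# * f (suc k) zero
        ≈⟨ +-congʳ (*-congˡ (eq k)) ⟩
      1# * sign k * f (suc k) zero + - 1# * sign k * 1# * f (suc k) zero
        ≈⟨ solve 4 (λ o m s a → o ⊗ s ⊗ a ⊕ m ⊗ s ⊗ o ⊗ a ⊜ (o ⊕ m ⊗ o) ⊗ (s ⊗ a)) refl
             1# (- 1#) (sign k) (f (suc k) zero) ⟩
      (1# + - 1# * 1#) * (sign k * f (suc k) zero)
        ≈⟨ *-congʳ (trans (+-congˡ (*-identityʳ (- 1#))) (-‿inverseʳ 1#)) ⟩
      0# * (sign k * f (suc k) zero)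
        ≈⟨ zeroˡ _ ⟩
      0# ∎

    flip² : ∀ a b e → - 1# * a * (- 1# * b) * e ≈ a * b * e
    flip² a b e = begin
      - 1# * a * (- 1# * b) * e
        ≈⟨ solve 4 (λ m a b e → m ⊗ a ⊗ (m ⊗ b) ⊗ e ⊜ m ⊗ m ⊗ (a ⊗ b ⊗ e)) refl (- 1#) a b e ⟩
      - 1# * - 1# * (a * b * e)
        ≈⟨ *-congʳ (trans (-1*x≈-x (- 1#)) (-‿involutive 1#)) ⟩
      1# * (a * b * e)
        ≈⟨ *-identityˡ _ ⟩
      a * b * e ∎

  -- `g` carries the entries in the two deleted columns and `h` the minor on the remaining ones,
  -- which does not see the order of deletion. Among pairs avoiding column 0 that column always
  -- survives, so the induction passes to `h ∘ lift 1`; this is why `h` takes an arbitrary choice of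
  -- columns.
  symmetric⇒exchangeable :
    ∀ n (g : Matrix (suc (suc n)) (suc (suc n))) (h : (Fin n → Fin (suc (suc n))) → Carrier)
      (f : Fin (suc (suc n)) → Fin (suc n) → Carrier) →
    (∀ i j → g i j ≈ g j i) → (∀ {φ ψ} → φ ≗ ψ → h φ ≈ h ψ) →
    (∀ j k → f j k ≈ g j (punchIn j k) * h (punchIn j ∘ punchIn k)) →
    Exchangeable (suc n) f
  symmetric⇒exchangeable n g h f g-sym h-cong f≈ = swap₀ , tail n g h f g-sym h-cong f≈
    where
    swap₀ : ∀ k → f zero k ≈ f (suc k) zero
    swap₀ k = begin
      f zero k                                     ≈⟨ f≈ zero k ⟩
      g zero (suc k) * h (suc ∘ punchIn k)         ≈⟨ *-congʳ (g-sym zero (suc k)) ⟩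
      g (suc k) zero * h (suc ∘ punchIn k)         ≈⟨ f≈ (suc k) zero ⟨
      f (suc k) zero                               ∎

    tail : ∀ n (g : Matrix (suc (suc n)) (suc (suc n))) (h : (Fin n → Fin (suc (suc n))) → Carrier)
             (f : Fin (suc (suc n)) → Fin (suc n) → Carrier) →
           (∀ i j → g i j ≈ g j i) → (∀ {φ ψ} → φ ≗ ψ → h φ ≈ h ψ) →
           (∀ j k → f j k ≈ g j (punchIn j k) * h (punchIn j ∘ punchIn k)) →
           Exchangeable n (λ j k → f (suc j) (suc k))
    tail zero    g h f g-sym h-cong f≈ = tt
    tail (suc n) g h f g-sym h-cong f≈ =
      symmetric⇒exchangeable n (λ i j → g (suc i) (suc j)) (h ∘ lift 1)
        (λ j k → f (suc j) (suc k))
        (λ i j → g-sym (suc i) (suc j))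
        (λ φ≗ψ → h-cong λ { zero → ≡.refl ; (suc l) → cong suc (φ≗ψ l) })
        (λ j k → trans (f≈ (suc j) (suc k))
          (*-congˡ (h-cong λ { zero → ≡.refl ; (suc l) → ≡.refl })))

  module _ {n} (M : Matrix n (suc (suc n))) where

    private
      h : (Fin n → Fin (suc (suc n))) → Carrier
      h φ = det (λ i l → M i (φ l))

      h-cong : ∀ {φ ψ} → φ ≗ ψ → h φ ≈ h ψ
      h-cong φ≗ψ = det-cong λ i l → reflexive (cong (M i) (φ≗ψ l))

      expansion : Vector Carrier (suc (suc n)) → Vector Carrier (suc (suc n)) →
                  Fin (suc (suc n)) → Fin (suc n) → Carrier
      expansion r s j k = r j * s (punchIn j k) * h (punchIn j ∘ punchIn k)

      summand : Vector Carrier (suc (suc n)) → Vector Carrier (suc (suc n)) →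
                Fin (suc (suc n)) → Fin (suc n) → Carrier
      summand r s j k = sign j * sign k * expansion r s j k

      det-expand₂ : ∀ r s → det (r ∷ s ∷ M) ≈ signedSum (expansion r s)
      det-expand₂ r s = sum-cong-≋ {x = laplace r (s ∷ M)} {sum ∘ summand r s} λ j → trans
        (*-distribˡ-sum (sign j * r j) (λ k → sign k * s (punchIn j k) * h (punchIn j ∘ punchIn k)))
        (sum-cong-≋ {y = summand r s j} λ k →
          solve 5 (λ e a e′ b d → e ⊗ a ⊗ (e′ ⊗ b ⊗ d) ⊜ e ⊗ e′ ⊗ (a ⊗ b ⊗ d)) refl
            (sign j) (r j) (sign k) (s (punchIn j k)) (h (punchIn j ∘ punchIn k)))

    det-repeat : ∀ r → det (r ∷ r ∷ M) ≈ 0#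
    det-repeat r = trans (det-expand₂ r r) (exchangeable⇒signedSum≈0 (suc n) (expansion r r)
      (symmetric⇒exchangeable n (λ i j → r i * r j) h (expansion r r)
        (λ i j → *-comm (r i) (r j)) h-cong
        (λ j k → refl)))

    det-swap : ∀ r s → det (r ∷ s ∷ M) ≈ - det (s ∷ r ∷ M)
    det-swap r s = inverseˡ-unique _ _ (begin
      det (r ∷ s ∷ M) + det (s ∷ r ∷ M)
        ≈⟨ +-cong (det-expand₂ r s) (det-expand₂ s r) ⟩
      signedSum (expansion r s) + signedSum (expansion s r)
        ≈⟨ ∑-distrib-+ (sum ∘ summand r s) (sum ∘ summand s r) ⟨
      ∑[ j < suc (suc n) ] (sum (summand r s j) + sum (summand s r j))
        ≈⟨ sum-cong-≋ (λ j → ∑-distrib-+ (summand r s j) (summand s r j)) ⟨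
      ∑[ j < suc (suc n) ] ∑[ k < suc n ] (summand r s j k + summand s r j k)
        ≈⟨ sum-cong-≋ (λ j → sum-cong-≋ λ k →
             distribˡ (sign j * sign k) (expansion r s j k) (expansion s r j k)) ⟨
      signedSum (λ j k → expansion r s j k + expansion s r j k)
        -- The coefficients of the added expansions, r i s j + s i r j, are symmetric in i and j, so
        -- the sum vanishes just as for a repeated row.
        ≈⟨ exchangeable⇒signedSum≈0 (suc n) (λ j k → expansion r s j k + expansion s r j k)
             (symmetric⇒exchangeable n
             (λ i j → r i * s j + s i * r j) h (λ j k → expansion r s j k + expansion s r j k)
             (λ i j → solve 4 (λ a b c d → a ⊗ b ⊕ c ⊗ d ⊜ d ⊗ c ⊕ b ⊗ a) refl
                        (r i) (s j) (s i) (r j))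
             h-cong (λ j k → sym (distribʳ _ _ _))) ⟩
      0# ∎)

  -- Induction on the position of the second copy. If it is not directly below, exchanging the first
  -- two rows puts `M zero` on top, and every minor along that row again has its first row repeated,
  -- one place nearer.
  det-member : ∀ {n} (M : Matrix n (suc n)) k → det (M k ∷ M) ≈ 0#
  det-member {suc n} M zero = trans (det-η (M zero) M) (det-repeat (M ∘ suc) (M zero))
  det-member {suc n} M (suc k) = begin
    det (r ∷ M)                       ≈⟨ det-η r M ⟩
    det (r ∷ M zero ∷ (M ∘ suc))      ≈⟨ det-swap (M ∘ suc) r (M zero) ⟩
    - det (M zero ∷ r ∷ (M ∘ suc))    ≈⟨ -‿cong (sum-≈0 {f = laplace (M zero) (r ∷ (M ∘ suc))} λ j → trans
                                           (*-congˡ (trans (det-minor-∷ j r (M ∘ suc))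
                                                           (det-member (minor j (M ∘ suc)) k)))
                                           (zeroʳ _)) ⟩
    - 0#                              ≈⟨ -0#≈0# ⟩
    0#                                ∎
    where r = M (suc k)

  -- The top rows below the first are restored inside the minors; the entrywise hypotheses survive
  -- the deletion of a column. The first row is then split by linearity, and each extra term has a
  -- row occurring twice.
  det-addTopRows : ∀ m {p} {M N : Matrix (m ℕ.+ p) (m ℕ.+ p)} (C : Matrix m p) →
    (∀ i j → N (i ↑ˡ p) j ≈ M (i ↑ˡ p) j + ∑[ k < p ] (C i k * M (m ↑ʳ k) j)) →
    (∀ k j → N (m ↑ʳ k) j ≈ M (m ↑ʳ k) j) →
    det N ≈ det M
  det-addTopRows zero    C top bottom = det-cong bottom
  det-addTopRows (suc m) {p} {M} {N} C top bottom = begin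
    det (N zero ∷ (N ∘ suc))
      ≈⟨ det-congMinors (N zero) {N ∘ suc} {M ∘ suc} (λ j → det-addTopRows m (C ∘ suc)
           (λ i l → top (suc i) (punchIn j l)) (λ k l → bottom k (punchIn j l))) ⟩
    det (N zero ∷ (M ∘ suc))
      ≈⟨ det-congFirstRow (M ∘ suc) (top zero) ⟩
    det ((λ j → M zero j + ∑[ k < p ] (C zero k * S k j)) ∷ (M ∘ suc))
      ≈⟨ det-+ (M zero) (λ j → ∑[ k < p ] (C zero k * S k j)) (M ∘ suc) ⟩
    det M + det ((λ j → ∑[ k < p ] (C zero k * S k j)) ∷ (M ∘ suc))
      ≈⟨ +-congˡ (trans (det-combination (C zero) S (M ∘ suc))
           (sum-≈0 λ k → trans (*-congˡ (det-member (M ∘ suc) (m ↑ʳ k))) (zeroʳ _))) ⟩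
    det M + 0#
      ≈⟨ +-identityʳ _ ⟩
    det M ∎
    where
    S : Matrix p (suc (m ℕ.+ p))
    S k = M (suc m ↑ʳ k)

  -- Once the first two rows are exchanged, `r` is the top row of every relevant minor after
  -- deletion of a column, so induction handles all rows but one. That row is treated separately
  -- before exchanging back.
  det-addFirstRow : ∀ {n} (r : Vector Carrier (suc n)) (a : Vector Carrier n) (M : Matrix n (suc n)) →
                    det (r ∷ (λ i j → M i j + a i * r j)) ≈ det (r ∷ M)
  det-addFirstRow {zero}  r a M = refl
  det-addFirstRow {suc n} r a M = begin
    det (r ∷ N)
      ≈⟨ det-η r N ⟩
    det (r ∷ N zero ∷ (N ∘ suc))
      ≈⟨ det-swap (N ∘ suc) r (N zero) ⟩
    - det (N zero ∷ r ∷ (N ∘ suc))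
      ≈⟨ -‿cong (det-congMinors (N zero) {r ∷ (N ∘ suc)} {r ∷ (M ∘ suc)} (λ j → begin
           det (minor j (r ∷ (N ∘ suc)))
             ≈⟨ det-minor-∷ j r (N ∘ suc) ⟩
           det ((r ∘ punchIn j) ∷ minor j (N ∘ suc))
             ≈⟨ det-addFirstRow (r ∘ punchIn j) (a ∘ suc) (minor j (M ∘ suc)) ⟩
           det ((r ∘ punchIn j) ∷ minor j (M ∘ suc))
             ≈⟨ det-minor-∷ j r (M ∘ suc) ⟨
           det (minor j (r ∷ (M ∘ suc))) ∎)) ⟩
    - det (N zero ∷ r ∷ (M ∘ suc))
      -- A single top row; the coefficients `a zero ∷ const 0#` select `r`, the first of the rows
      -- beneath it.
      ≈⟨ -‿cong (det-addTopRows 1 {M = M zero ∷ r ∷ (M ∘ suc)} {N = N zero ∷ r ∷ (M ∘ suc)}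
           (λ _ → a zero ∷ const 0#)
           (λ { zero j → +-congˡ (sym (trans (+-congˡ (sum-≈0 {n} λ _ → zeroˡ _)) (+-identityʳ _))) })
           (λ _ _ → refl)) ⟩
    - det (M zero ∷ r ∷ (M ∘ suc))
      ≈⟨ det-swap (M ∘ suc) r (M zero) ⟨
    det (r ∷ M zero ∷ (M ∘ suc))
      ≈⟨ det-η r M ⟨
    det (r ∷ M) ∎
    where
    N : Matrix (suc n) (suc (suc n))
    N i j = M i j + a i * r j

  -- Block matrices and Schur complements.

  punchIn-↑ˡ-↑ˡ : ∀ {m} p (i : Fin (suc m)) (b : Fin m) → punchIn (i ↑ˡ p) (b ↑ˡ p) ≡ punchIn i b ↑ˡ p
  punchIn-↑ˡ-↑ˡ p zero    b       = ≡.refl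
  punchIn-↑ˡ-↑ˡ p (suc i) zero    = ≡.refl
  punchIn-↑ˡ-↑ˡ p (suc i) (suc b) = cong suc (punchIn-↑ˡ-↑ˡ p i b)

  punchIn-↑ˡ-↑ʳ : ∀ m {p} (i : Fin (suc m)) (l : Fin p) → punchIn (i ↑ˡ p) (m ↑ʳ l) ≡ suc m ↑ʳ l
  punchIn-↑ˡ-↑ʳ m       zero    l = ≡.refl
  punchIn-↑ˡ-↑ʳ (suc m) (suc i) l = cong suc (punchIn-↑ˡ-↑ʳ m i l)

  -- In the expansion along the first row only columns of the first block contribute. Deleting one
  -- of them leaves a block lower triangular matrix with the same last block, so `det D` factors out
  -- of every term.
  det-blockLowerTriangular : ∀ m {p} (M : Matrix (m ℕ.+ p) (m ℕ.+ p)) →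
    (∀ i l → M (i ↑ˡ p) (m ↑ʳ l) ≈ 0#) →
    det M ≈ det (λ i j → M (i ↑ˡ p) (j ↑ˡ p)) * det (λ k l → M (m ↑ʳ k) (m ↑ʳ l))
  det-blockLowerTriangular zero        M M₁₂≈0 = sym (*-identityˡ _)
  det-blockLowerTriangular (suc m) {p} M M₁₂≈0 = begin
    det M
      ≈⟨ sum-split (suc m) (λ j → sign j * M zero j * det (minor j (M ∘ suc))) ⟩
    ∑[ j < suc m ] (sign (j ↑ˡ p) * M zero (j ↑ˡ p) * det (minor (j ↑ˡ p) (M ∘ suc))) +
    ∑[ l < p ] (sign (suc m ↑ʳ l) * M zero (suc m ↑ʳ l) * det (minor (suc m ↑ʳ l) (M ∘ suc)))
      ≈⟨ +-cong (sum-cong-≋ {suc m} {λ j → laplace (M zero) (M ∘ suc) (j ↑ˡ p)}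
                             {λ j → sign j * A zero j * (det (minor j (A ∘ suc)) * det D)} λ j →
                  *-cong (*-congʳ (reflexive (cong ((- 1#) ^_) (Fin.toℕ-↑ˡ j p))))
                         (minorFactors j))
                (sum-≈0 λ l → trans (*-congʳ (trans (*-congˡ (M₁₂≈0 zero l)) (zeroʳ _))) (zeroˡ _)) ⟩
    ∑[ j < suc m ] (sign j * A zero j * (det (minor j (A ∘ suc)) * det D)) + 0#
      ≈⟨ +-identityʳ _ ⟩
    ∑[ j < suc m ] (sign j * A zero j * (det (minor j (A ∘ suc)) * det D))
      ≈⟨ sum-cong-≋ (λ j → sym (*-assoc (sign j * A zero j) (det (minor j (A ∘ suc))) (det D))) ⟩
    ∑[ j < suc m ] (sign j * A zero j * det (minor j (A ∘ suc)) * det D)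
      ≈⟨ *-distribʳ-sum (det D) (λ j → sign j * A zero j * det (minor j (A ∘ suc))) ⟨
    det A * det D ∎
    where
    A : Matrix (suc m) (suc m)
    A i j = M (i ↑ˡ p) (j ↑ˡ p)

    D : Matrix p p
    D k l = M (suc m ↑ʳ k) (suc m ↑ʳ l)

    minorFactors : ∀ j → det (minor (j ↑ˡ p) (M ∘ suc)) ≈ det (minor j (A ∘ suc)) * det D
    minorFactors j = trans
      (det-blockLowerTriangular m (minor (j ↑ˡ p) (M ∘ suc)) λ i l →
        trans (reflexive (cong (M (suc (i ↑ˡ p))) (punchIn-↑ˡ-↑ʳ m j l))) (M₁₂≈0 (suc i) l))
      (*-cong (det-cong λ i l → reflexive (cong (M (suc (i ↑ˡ p))) (punchIn-↑ˡ-↑ˡ p j l)))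
              (det-cong λ k l → reflexive (cong (M (suc m ↑ʳ k)) (punchIn-↑ˡ-↑ʳ m j l))))

  -- C plays the role of - M₁₂ M₂₂⁻¹, so that the first factor is the
  -- determinant of the Schur complement of M₂₂.
  det-schur : ∀ m {p} (M : Matrix (m ℕ.+ p) (m ℕ.+ p)) (C : Matrix m p) →
    (∀ i l → M (i ↑ˡ p) (m ↑ʳ l) + ∑[ k < p ] (C i k * M (m ↑ʳ k) (m ↑ʳ l)) ≈ 0#) →
    det M ≈ det (λ i j → M (i ↑ˡ p) (j ↑ˡ p) + ∑[ k < p ] (C i k * M (m ↑ʳ k) (j ↑ˡ p))) *
            det (λ k l → M (m ↑ʳ k) (m ↑ʳ l))
  det-schur m {p} M C eliminated = begin
    det M
      ≈⟨ det-addTopRows m C top bottom ⟨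
    det N
      ≈⟨ det-blockLowerTriangular m N (λ i l → trans (top i (m ↑ʳ l)) (eliminated i l)) ⟩
    det (λ i j → N (i ↑ˡ p) (j ↑ˡ p)) * det (λ k l → N (m ↑ʳ k) (m ↑ʳ l))
      ≈⟨ *-cong (det-cong λ i j → top i (j ↑ˡ p)) (det-cong λ k l → bottom k (m ↑ʳ l)) ⟩
    det (λ i j → M (i ↑ˡ p) (j ↑ˡ p) + ∑[ k < p ] (C i k * M (m ↑ʳ k) (j ↑ˡ p))) *
    det (λ k l → M (m ↑ʳ k) (m ↑ʳ l)) ∎
    where
    N : Matrix (m ℕ.+ p) (m ℕ.+ p)
    N a b = [ (λ i → M a b + ∑[ k < p ] (C i k * M (m ↑ʳ k) b)) , (λ _ → M a b) ]′ (splitAt m a)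

    top : ∀ i b → N (i ↑ˡ p) b ≈ M (i ↑ˡ p) b + ∑[ k < p ] (C i k * M (m ↑ʳ k) b)
    top i b = reflexive (cong [ _ , _ ]′ (Fin.splitAt-↑ˡ m i p))

    bottom : ∀ k b → N (m ↑ʳ k) b ≈ M (m ↑ʳ k) b
    bottom k b = reflexive (cong [ _ , _ ]′ (Fin.splitAt-↑ʳ m p k))

  -- Expansion when the first column is cleared, and rank one perturbations.

  det-zeroColumn : ∀ {n} (M : Matrix (suc n) (suc n)) → (∀ i → M i zero ≈ 0#) → det M ≈ 0#
  det-zeroColumn M M₀≈0 = sum-≈0 {f = laplace (M zero) (M ∘ suc)} λ
    { zero            → trans (*-congʳ (trans (*-congˡ (M₀≈0 zero)) (zeroʳ _))) (zeroˡ _)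
    -- Splitting `j` reveals that the minor is nonempty; its first column is then a part of the zero
    -- column of `M`.
    ; (suc j@zero)    → trans (*-congˡ (det-zeroColumn (minor (suc j) (M ∘ suc)) (M₀≈0 ∘ suc))) (zeroʳ _)
    ; (suc j@(suc _)) → trans (*-congˡ (det-zeroColumn (minor (suc j) (M ∘ suc)) (M₀≈0 ∘ suc))) (zeroʳ _)
    }

  det-firstColumn : ∀ {n} (M : Matrix (suc n) (suc n)) → (∀ i → M (suc i) zero ≈ 0#) →
                    det M ≈ M zero zero * det (λ i j → M (suc i) (suc j))
  det-firstColumn {n} M M₀≈0 = begin
    1# * M zero zero * D + ∑[ j < n ] (sign (suc j) * M zero (suc j) * det (minor (suc j) (M ∘ suc)))
      ≈⟨ +-cong (*-congʳ (*-identityˡ _)) (sum-≈0 (vanishing M M₀≈0)) ⟩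
    M zero zero * D + 0#
      ≈⟨ +-identityʳ _ ⟩
    M zero zero * D ∎
    where
    D = det (λ i j → M (suc i) (suc j))

    vanishing : ∀ {n} (M : Matrix (suc n) (suc n)) → (∀ i → M (suc i) zero ≈ 0#) →
                ∀ j → sign (suc j) * M zero (suc j) * det (minor (suc j) (M ∘ suc)) ≈ 0#
    vanishing {suc n} M M₀≈0 j =
      trans (*-congˡ (det-zeroColumn (minor (suc j) (M ∘ suc)) M₀≈0)) (zeroʳ _)

  det-1×1 : (M : Matrix 1 1) → det M ≈ M zero zero
  det-1×1 M = trans (+-identityʳ _) (trans (*-identityʳ _) (*-identityˡ _))

  det-scalar : ∀ n a → det (a ·ᴹ Iᴹ n) ≈ a ^ n
  det-scalar zero    a = refl
  det-scalar (suc n) a = trans (det-firstColumn (a ·ᴹ Iᴹ (suc n)) (λ _ → zeroʳ a))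
    (*-cong (*-identityʳ a) (det-scalar n a))

  -- Both sides are the determinant of the bordered matrix (1 u ; v X).
  det-rankOne : ∀ {n} (X : Matrix n n) (u v a : Vector Carrier n) →
    (∀ j → ∑[ k < n ] (a k * X k j) ≈ u j) →
    det (λ i j → X i j - v i * u j) ≈ (1# - ∑[ k < n ] (a k * v k)) * det X
  det-rankOne {n} X u v a aX≈u = begin
    det (λ i j → X i j - v i * u j)
      ≈⟨ det-cong (λ i j → +-congˡ (-‿distribˡ-* (v i) (u j))) ⟩
    det (λ i j → X i j + - v i * u j)
      ≈⟨ *-identityˡ _ ⟨
    1# * det (λ i j → X i j + - v i * u j)
      -- Read upwards: subtracting v i times the first row (1 u) clears the column v below the
      -- corner 1 and turns X into X - v u.
      ≈⟨ det-firstColumn (r ∷ (λ i j → M i j + - v i * r j))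
           (λ i → trans (+-congˡ (*-identityʳ _)) (-‿inverseʳ (v i))) ⟨
    det (r ∷ (λ i j → M i j + - v i * r j))
      ≈⟨ det-addFirstRow r (λ i → - v i) M ⟩
    det (r ∷ M)
      -- The same bordered matrix is now reduced at the block X: `a` plays the role of u X⁻¹, so
      -- that - a clears u and leaves 1 - a v in the corner.
      ≈⟨ det-schur 1 (r ∷ M) (λ _ k → - a k) (λ { zero l → begin
           u l + ∑[ k < n ] (- a k * X k l)      ≈⟨ +-congˡ (sum-neg a (λ k → X k l)) ⟩
           u l - ∑[ k < n ] (a k * X k l)        ≈⟨ +-congˡ (-‿cong (aX≈u l)) ⟩
           u l - u l                             ≈⟨ -‿inverseʳ (u l) ⟩
           0#                                    ∎ }) ⟩
    det schur * det X
      ≈⟨ *-congʳ (trans (det-1×1 schur) (+-congˡ (sum-neg a v))) ⟩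
    (1# - ∑[ k < n ] (a k * v k)) * det X ∎
    where
    r : Vector Carrier (suc n)
    r = 1# ∷ u

    M : Matrix n (suc n)
    M i = v i ∷ X i

    schur : Matrix 1 1
    schur i j = (r ∷ M) (i ↑ˡ n) (j ↑ˡ n) + ∑[ k < n ] (- a k * M k (j ↑ˡ n))

    sum-neg : ∀ {n} (a b : Vector Carrier n) → ∑[ k < n ] (- a k * b k) ≈ - ∑[ k < n ] (a k * b k)
    sum-neg {n} a b = begin
      ∑[ k < n ] (- a k * b k)
        ≈⟨ sum-cong-≋ (λ k → trans (sym (-‿distribˡ-* (a k) (b k))) (sym (-1*x≈-x _))) ⟩
      ∑[ k < n ] (- 1# * (a k * b k))
        ≈⟨ *-distribˡ-sum (- 1#) (λ k → a k * b k) ⟨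
      - 1# * ∑[ k < n ] (a k * b k)
        ≈⟨ -1*x≈-x _ ⟩
      - ∑[ k < n ] (a k * b k) ∎

-- Identity matrices, products and inverses.

module MatrixAlgebra {c ℓ} (R : CommutativeRing c ℓ) where

  open CommutativeRing R hiding (zero)
  open Matrices R
  open Vector using (_∷_)
  open Determinants R using (sum-≈0)
  open Algebra.Properties.Ring ring using (-‿distribˡ-*; -‿distribʳ-*)
  open Algebra.Properties.Semiring.Sum semiring
    using (sum; ∑-comm; ∑-distrib-+; sum-cong-≋; *-distribˡ-sum; *-distribʳ-sum; sum-syntax)
  open Algebra.Solver.Ring.NaturalCoefficients.Default commutativeSemiring
    using (solve) renaming (_:=_ to _⊜_; _:+_ to _⊕_; _:*_ to _⊗_)
  open Relation.Binary.Reasoning.Setoid setoid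

  Iᴹ-sym : ∀ {n} (i j : Fin n) → Iᴹ n i j ≡ Iᴹ n j i
  Iᴹ-sym zero    zero    = ≡.refl
  Iᴹ-sym zero    (suc j) = ≡.refl
  Iᴹ-sym (suc i) zero    = ≡.refl
  Iᴹ-sym (suc i) (suc j) = Iᴹ-sym i j

  Iᴹ-↑ˡ-↑ˡ : ∀ {m} p (i j : Fin m) → Iᴹ (m ℕ.+ p) (i ↑ˡ p) (j ↑ˡ p) ≡ Iᴹ m i j
  Iᴹ-↑ˡ-↑ˡ p zero    zero    = ≡.refl
  Iᴹ-↑ˡ-↑ˡ p zero    (suc j) = ≡.refl
  Iᴹ-↑ˡ-↑ˡ p (suc i) zero    = ≡.refl
  Iᴹ-↑ˡ-↑ˡ p (suc i) (suc j) = Iᴹ-↑ˡ-↑ˡ p i j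

  Iᴹ-↑ʳ-↑ʳ : ∀ m {p} (k l : Fin p) → Iᴹ (m ℕ.+ p) (m ↑ʳ k) (m ↑ʳ l) ≡ Iᴹ p k l
  Iᴹ-↑ʳ-↑ʳ zero    k l = ≡.refl
  Iᴹ-↑ʳ-↑ʳ (suc m) k l = Iᴹ-↑ʳ-↑ʳ m k l

  Iᴹ-↑ˡ-↑ʳ : ∀ {m p} (i : Fin m) (k : Fin p) → Iᴹ (m ℕ.+ p) (i ↑ˡ p) (m ↑ʳ k) ≡ 0#
  Iᴹ-↑ˡ-↑ʳ zero    k = ≡.refl
  Iᴹ-↑ˡ-↑ʳ (suc i) k = Iᴹ-↑ˡ-↑ʳ i k

  Iᴹ-↑ʳ-↑ˡ : ∀ {m p} (k : Fin p) (i : Fin m) → Iᴹ (m ℕ.+ p) (m ↑ʳ k) (i ↑ˡ p) ≡ 0#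
  Iᴹ-↑ʳ-↑ˡ {m} {p} k i = ≡.trans (Iᴹ-sym (m ↑ʳ k) (i ↑ˡ p)) (Iᴹ-↑ˡ-↑ʳ i k)

  sum-*-Iᴹ : ∀ {n} (f : Vector Carrier n) i → ∑[ k < n ] (f k * Iᴹ n k i) ≈ f i
  sum-*-Iᴹ f zero    = trans (+-cong (*-identityʳ _) (sum-≈0 λ k → zeroʳ (f (suc k)))) (+-identityʳ _)
  sum-*-Iᴹ f (suc i) = trans (+-cong (zeroʳ _) (sum-*-Iᴹ (f ∘ suc) i)) (+-identityˡ _)

  sum-Iᴹ-* : ∀ {n} (f : Vector Carrier n) i → ∑[ k < n ] (Iᴹ n i k * f k) ≈ f i
  sum-Iᴹ-* {n} f i = trans
    (sum-cong-≋ {x = λ k → Iᴹ n i k * f k} {λ k → f k * Iᴹ n k i} λ k →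
      trans (*-comm (Iᴹ n i k) (f k)) (*-congˡ (reflexive (Iᴹ-sym i k))))
    (sum-*-Iᴹ f i)

  *ᴹ-cong : ∀ {m n p} {A A′ : Matrix m n} {B B′ : Matrix n p} →
            A ≈ᴹ A′ → B ≈ᴹ B′ → (A *ᴹ B) ≈ᴹ (A′ *ᴹ B′)
  *ᴹ-cong A≈A′ B≈B′ i k = sum-cong-≋ λ j → *-cong (A≈A′ i j) (B≈B′ j k)

  *ᴹ-assoc : ∀ {m n p q} (A : Matrix m n) (B : Matrix n p) (C : Matrix p q) →
             (A *ᴹ B) *ᴹ C ≈ᴹ A *ᴹ (B *ᴹ C)
  *ᴹ-assoc {m} {n} {p} {q} A B C i l = begin
    ∑[ k < p ] ((∑[ j < n ] (A i j * B j k)) * C k l)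
      ≈⟨ sum-cong-≋ (λ k → *-distribʳ-sum (C k l) (λ j → A i j * B j k)) ⟩
    ∑[ k < p ] ∑[ j < n ] (A i j * B j k * C k l)
      ≈⟨ ∑-comm (λ k j → A i j * B j k * C k l) ⟩
    ∑[ j < n ] ∑[ k < p ] (A i j * B j k * C k l)
      ≈⟨ sum-cong-≋ (λ j → trans (sum-cong-≋ λ k → *-assoc (A i j) (B j k) (C k l))
           (sym (*-distribˡ-sum (A i j) (λ k → B j k * C k l)))) ⟩
    ∑[ j < n ] (A i j * (∑[ k < p ] (B j k * C k l))) ∎

  *ᴹ-identityˡ : ∀ {m n} (A : Matrix m n) → Iᴹ m *ᴹ A ≈ᴹ A
  *ᴹ-identityˡ A i j = sum-Iᴹ-* (λ k → A k j) i

  *ᴹ-identityʳ : ∀ {m n} (A : Matrix m n) → A *ᴹ Iᴹ n ≈ᴹ A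
  *ᴹ-identityʳ A i j = sum-*-Iᴹ (A i) j

  -- L = L (M N) = (L M) N = N, so one-sided inverses constructed independently combine into a
  -- two-sided one.
  inverse : ∀ {n} {M : Matrix n n} (L : Matrix n n) → L *ᴹ M ≈ᴹ Iᴹ n →
            (N : Matrix n n) → M *ᴹ N ≈ᴹ Iᴹ n → Inverse M
  inverse {n} {M} L LM≈I N MN≈I = record
    { inv      = L
    ; inverseˡ = LM≈I
    ; inverseʳ = λ i j → trans (*ᴹ-cong {A = M} {M} {L} {N} (λ _ _ → refl) L≈N i j) (MN≈I i j)
    }
    where
    L≈N : L ≈ᴹ N
    L≈N i j = begin
      L i j                    ≈⟨ *ᴹ-identityʳ L i j ⟨
      (L *ᴹ Iᴹ n) i j          ≈⟨ *ᴹ-cong {A = L} {L} {M *ᴹ N} {Iᴹ n} (λ _ _ → refl) MN≈I i j ⟨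
      (L *ᴹ (M *ᴹ N)) i j      ≈⟨ *ᴹ-assoc L M N i j ⟨
      (L *ᴹ M *ᴹ N) i j        ≈⟨ *ᴹ-cong {A = L *ᴹ M} {Iᴹ n} {N} {N} LM≈I (λ _ _ → refl) i j ⟩
      (Iᴹ n *ᴹ N) i j          ≈⟨ *ᴹ-identityˡ N i j ⟩
      N i j                    ∎

  -- The row 𝟙ᵀ M⁻¹ serves as an elimination multiplier. When M is a characteristic matrix, its
  -- entries add up to the coronal, which is how coronals enter the determinant.
  columnSums-inverse : ∀ {n} {M : Matrix n n} (B : Inverse M) j →
                       ∑[ k < n ] ((𝟙ᵀ n *ᴹ inv B) zero k * M k j) ≈ 1#
  columnSums-inverse {n} {M} B j = begin
    (𝟙ᵀ n *ᴹ inv B *ᴹ M) zero j      ≈⟨ *ᴹ-assoc (𝟙ᵀ n) (inv B) M zero j ⟩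
    (𝟙ᵀ n *ᴹ (inv B *ᴹ M)) zero j    ≈⟨ *ᴹ-cong {A = 𝟙ᵀ n} {𝟙ᵀ n} {inv B *ᴹ M} {Iᴹ n}
                                          (λ _ _ → refl) (inverseˡ B) zero j ⟩
    (𝟙ᵀ n *ᴹ Iᴹ n) zero j            ≈⟨ *ᴹ-identityʳ (𝟙ᵀ n) zero j ⟩
    1#                               ∎

  -- A non-unital subring all of whose elements a have 1 - a invertible; the
  -- inverse is 1 + b where b ≈ a + a * b.
  record QuasiRegular {p} (𝔪 : Pred Carrier p) : Set (c ⊔ ℓ ⊔ p) where
    field
      resp         : ∀ {a b} → a ≈ b → 𝔪 a → 𝔪 b
      0∈           : 𝔪 0#
      +-closed     : ∀ {a b} → 𝔪 a → 𝔪 b → 𝔪 (a + b)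
      *-closed     : ∀ {a b} → 𝔪 a → 𝔪 b → 𝔪 (a * b)
      quasiInverse : ∀ {a} → 𝔪 a → ∃[ b ] 𝔪 b × b ≈ a + a * b

    sum-closed : ∀ {n} (f : Vector Carrier n) → (∀ i → 𝔪 (f i)) → 𝔪 (sum f)
    sum-closed {zero}  f f∈ = 0∈
    sum-closed {suc n} f f∈ = +-closed (f∈ zero) (sum-closed (f ∘ suc) (f∈ ∘ suc))

  -- Gaussian elimination over a quasi-regular subring.

  module _ {p} {𝔪 : Pred Carrier p} (quasiRegular : QuasiRegular 𝔪) where

    open QuasiRegular quasiRegular

    -- The system (I - N) y = b, solved by eliminating the first unknown.
    fixedPoint : ∀ {n} (N : Matrix n n) → (∀ i j → 𝔪 (N i j)) → (b : Vector Carrier n) →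
                 Σ[ y ∈ Vector Carrier n ] ∀ i → y i ≈ b i + ∑[ j < n ] (N i j * y j)
    fixedPoint {zero}  N N∈ b = b , λ ()
    fixedPoint {suc n} N N∈ b with quasiInverse (N∈ zero zero)
    ... | a⁺ , a⁺∈ , a⁺≈ = y₀ ∷ y , λ { zero → eq₀ ; (suc i) → eqₛ i }
      where
      a = N zero zero
      -- The inverse of the pivot 1 - a; it is used for the elimination and for the back
      -- substitution `y₀`.
      e = 1# + a⁺

      u v : Vector Carrier n
      u j = N zero (suc j)
      v i = N (suc i) zero

      -- I - N′ is the Schur complement of the pivot in I - N. Writing e u as u + a⁺ u keeps every
      -- factor in 𝔪, whereas e = 1 + a⁺ need not lie there.
      N′ : Matrix n n
      N′ i j = N (suc i) (suc j) + v i * (u j + a⁺ * u j)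

      IH = fixedPoint N′
        (λ i j → +-closed (N∈ (suc i) (suc j)) (*-closed (N∈ (suc i) zero)
          (+-closed (N∈ zero (suc j)) (*-closed a⁺∈ (N∈ zero (suc j))))))
        (λ i → b (suc i) + v i * (e * b zero))
      y  = proj₁ IH
      uy = ∑[ j < n ] (u j * y j)
      y₀ = e * (b zero + uy)

      eq₀ : y₀ ≈ b zero + (a * y₀ + uy)
      eq₀ = begin
        (1# + a⁺) * (b zero + uy)
          ≈⟨ *-congʳ (+-congˡ a⁺≈) ⟩
        (1# + (a + a * a⁺)) * (b zero + uy)
          -- The unit enters the solver as a variable `o`, so it has to appear as an explicit factor
          -- of `a`.
          ≈⟨ *-congʳ (+-congˡ (+-congʳ (*-identityʳ a))) ⟨
        (1# + (a * 1# + a * a⁺)) * (b zero + uy)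
          ≈⟨ solve 5 (λ o a a⁺ b w → (o ⊕ (a ⊗ o ⊕ a ⊗ a⁺)) ⊗ (b ⊕ w) ⊜
                                     o ⊗ b ⊕ (a ⊗ ((o ⊕ a⁺) ⊗ (b ⊕ w)) ⊕ o ⊗ w))
               refl 1# a a⁺ (b zero) uy ⟩
        1# * b zero + (a * y₀ + 1# * uy)
          ≈⟨ +-cong (*-identityˡ _) (+-congˡ (*-identityˡ uy)) ⟩
        b zero + (a * y₀ + uy) ∎

      eqₛ : ∀ i → y i ≈ b (suc i) + (v i * y₀ + ∑[ j < n ] (N (suc i) (suc j) * y j))
      eqₛ i = begin
        y i
          ≈⟨ proj₂ IH i ⟩
        b (suc i) + v i * (e * b zero) + ∑[ j < n ] (N′ i j * y j)
          ≈⟨ +-congˡ (begin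
               ∑[ j < n ] (N′ i j * y j)
                 ≈⟨ sum-cong-≋ (λ j → begin
                      (N (suc i) (suc j) + v i * (u j + a⁺ * u j)) * y j
                        ≈⟨ *-congʳ (+-congˡ (*-congˡ (+-congʳ (*-identityˡ (u j))))) ⟨
                      (N (suc i) (suc j) + v i * (1# * u j + a⁺ * u j)) * y j
                        ≈⟨ solve 6 (λ w v o a⁺ u y → (w ⊕ v ⊗ (o ⊗ u ⊕ a⁺ ⊗ u)) ⊗ y ⊜
                                                     w ⊗ y ⊕ v ⊗ (o ⊕ a⁺) ⊗ (u ⊗ y))
                             refl (N (suc i) (suc j)) (v i) 1# a⁺ (u j) (y j) ⟩
                      N (suc i) (suc j) * y j + v i * e * (u j * y j) ∎) ⟩
               ∑[ j < n ] (N (suc i) (suc j) * y j + v i * e * (u j * y j))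
                 ≈⟨ ∑-distrib-+ (λ j → N (suc i) (suc j) * y j) (λ j → v i * e * (u j * y j)) ⟩
               Wy + ∑[ j < n ] (v i * e * (u j * y j))
                 ≈⟨ +-congˡ (*-distribˡ-sum (v i * e) (λ j → u j * y j)) ⟨
               Wy + v i * e * uy ∎) ⟩
        b (suc i) + v i * (e * b zero) + (Wy + v i * e * uy)
          ≈⟨ solve 6 (λ b v e b₀ w z → b ⊕ v ⊗ (e ⊗ b₀) ⊕ (w ⊕ v ⊗ e ⊗ z) ⊜
                                       b ⊕ (v ⊗ (e ⊗ (b₀ ⊕ z)) ⊕ w))
               refl (b (suc i)) (v i) e (b zero) Wy uy ⟩
        b (suc i) + (v i * y₀ + Wy) ∎
        where Wy = ∑[ j < n ] (N (suc i) (suc j) * y j)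

    module _ {x t} (x*t≈1 : x * t ≈ 1#) where

      -- With t = x⁻¹, the matrix is x (I - t M). Column k of `Z` solves (I - t M) z = e_k by
      -- `fixedPoint`, and the right inverse is t Z.
      charMatrix-rightInverse : ∀ {n} (M : Matrix n n) → (∀ i j → 𝔪 (t * M i j)) →
                                Σ[ N ∈ Matrix n n ] charMatrix x M *ᴹ N ≈ᴹ Iᴹ n
      charMatrix-rightInverse {n} M tM∈ = (λ j k → t * Z j k) , λ i k → begin
        ∑[ j < n ] ((x * Iᴹ n i j - M i j) * (t * Z j k))
          ≈⟨ sum-cong-≋ (λ j → expand (Iᴹ n i j) (M i j) (Z j k)) ⟩
        ∑[ j < n ] (Iᴹ n i j * Z j k + t * M i j * (- Z j k))
          ≈⟨ ∑-distrib-+ (λ j → Iᴹ n i j * Z j k) (λ j → t * M i j * (- Z j k)) ⟩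
        (Iᴹ n *ᴹ Z) i k + ∑[ j < n ] (t * M i j * (- Z j k))
          ≈⟨ +-congʳ (trans (*ᴹ-identityˡ Z i k) (Z-eq k i)) ⟩
        Iᴹ n i k + ∑[ j < n ] (t * M i j * Z j k) + ∑[ j < n ] (t * M i j * (- Z j k))
          ≈⟨ +-assoc _ _ _ ⟩
        Iᴹ n i k + (∑[ j < n ] (t * M i j * Z j k) + ∑[ j < n ] (t * M i j * (- Z j k)))
          ≈⟨ +-congˡ (∑-distrib-+ (λ j → t * M i j * Z j k) (λ j → t * M i j * (- Z j k))) ⟨
        Iᴹ n i k + ∑[ j < n ] (t * M i j * Z j k + t * M i j * (- Z j k))
          ≈⟨ +-congˡ (sum-≈0 λ j → trans (sym (distribˡ (t * M i j) _ _))
               (trans (*-congˡ (-‿inverseʳ (Z j k))) (zeroʳ _))) ⟩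
        Iᴹ n i k + 0#
          ≈⟨ +-identityʳ _ ⟩
        Iᴹ n i k ∎
        where
        column = λ k → fixedPoint (t ·ᴹ M) tM∈ (λ i → Iᴹ n i k)

        Z : Matrix n n
        Z j k = proj₁ (column k) j

        Z-eq : ∀ k i → Z i k ≈ Iᴹ n i k + ∑[ j < n ] (t * M i j * Z j k)
        Z-eq k = proj₂ (column k)

        expand : ∀ d m z → (x * d - m) * (t * z) ≈ d * z + t * m * (- z)
        expand d m z = begin
          (x * d - m) * (t * z)
            ≈⟨ solve 5 (λ x t d m z → (x ⊗ d ⊕ m) ⊗ (t ⊗ z) ⊜ x ⊗ t ⊗ (d ⊗ z) ⊕ t ⊗ (m ⊗ z))
                 refl x t d (- m) z ⟩
          x * t * (d * z) + t * (- m * z)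
            ≈⟨ +-cong (trans (*-congʳ x*t≈1) (*-identityˡ _))
                      (*-congˡ (trans (sym (-‿distribˡ-* m z)) (-‿distribʳ-* m z))) ⟩
          d * z + t * (m * - z)
            ≈⟨ +-congˡ (*-assoc t m (- z)) ⟨
          d * z + t * m * (- z) ∎

      -- A left inverse is the transpose of a right inverse for the transposed matrix, whose entries
      -- satisfy the same membership condition.
      charMatrix-inverse : ∀ {n} (M : Matrix n n) → (∀ i j → 𝔪 (t * M i j)) →
                           Inverse (charMatrix x M)
      charMatrix-inverse {n} M tM∈ =
        inverse (flip Lᵀ) (λ i k → begin
          ∑[ j < n ] (Lᵀ j i * charMatrix x M j k)
            ≈⟨ sum-cong-≋ (λ j → begin
                 Lᵀ j i * (x * Iᴹ n j k - M j k)
                   ≈⟨ *-comm (Lᵀ j i) _ ⟩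
                 (x * Iᴹ n j k - M j k) * Lᵀ j i
                   ≡⟨ cong (λ d → (x * d - M j k) * Lᵀ j i) (Iᴹ-sym j k) ⟩
                 (x * Iᴹ n k j - M j k) * Lᵀ j i ∎) ⟩
          (charMatrix x (flip M) *ᴹ Lᵀ) k i
            ≈⟨ proj₂ transposed k i ⟩
          Iᴹ n k i
            ≡⟨ Iᴹ-sym k i ⟩
          Iᴹ n i k ∎)
          (proj₁ direct) (proj₂ direct)
        where
        direct     = charMatrix-rightInverse M tM∈
        transposed = charMatrix-rightInverse (flip M) (flip tM∈)
        Lᵀ         = proj₁ transposed

-- The characteristic polynomial of a splitting join.

module SplittingJoins {c ℓ} (R : CommutativeRing c ℓ) where

  open CommutativeRing R hiding (zero)
  open Matrices R
  open Determinants R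
  open MatrixAlgebra R
  open Algebra.Properties.Group +-group using () renaming (⁻¹-involutive to -‿involutive)
  open Algebra.Properties.AbelianGroup +-abelianGroup using (⁻¹-∙-comm)
  open Algebra.Properties.Ring ring using (-‿distribˡ-*; -‿distribʳ-*; -0#≈0#)
  open Algebra.Properties.Semiring.Exp semiring using (_^_)
  open Algebra.Properties.Semiring.Sum semiring
    using (sum; sum-cong-≋; *-distribˡ-sum; *-distribʳ-sum; sum-syntax)
  open Algebra.Solver.Ring.NaturalCoefficients.Default commutativeSemiring
    using (solve) renaming (_:=_ to _⊜_; _:*_ to _⊗_)
  open Relation.Binary.Reasoning.Setoid setoid

  adjacency-sym : ∀ {n} (G : Graph (Fin n)) i j → adjacency G i j ≡ adjacency G j i
  adjacency-sym G i j = cong (if_then 1# else 0#)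
    (does-⇔ (mk⇔ (Graph.symmetric G) (Graph.symmetric G)) (adj? G i j) (adj? G j i))

  -- `numbering` does not reduce on injected indices of variable length. With the images as
  -- variables, matching on `refl` substitutes them, and adjacency in `Γ` then computes by cases.
  charMatrix-pullback : ∀ {n} {V : Set} (f : Fin n → V) (Γ : Graph V) x {a b v w} →
    f a ≡ v → f b ≡ w →
    charMatrix x (adjacency (pullback f Γ)) a b ≡
      x * Iᴹ n a b - (if does (adj? Γ v w) then 1# else 0#)
  charMatrix-pullback f Γ x ≡.refl ≡.refl = ≡.refl

  module _ {n₁ n₂} (G₁ : Graph (Fin n₁)) (G₂ : Graph (Fin n₂)) (H : Graph (Fin n₁))
           {x t} (x*t≈1 : x * t ≈ 1#) where

    private
      A₁ = adjacency G₁
      A₂ = adjacency G₂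
      B  = adjacency H
      Γ  = splittingJoin G₁ G₂ (Adj H) (adj? H)

      P = charMatrix x (adjacency (pullback (numbering n₁ n₂) Γ))

      old : Fin (n₁ ℕ.+ n₂) → Fin ((n₁ ℕ.+ n₂) ℕ.+ n₁)
      old a = a ↑ˡ n₁

      new : Fin n₁ → Fin ((n₁ ℕ.+ n₂) ℕ.+ n₁)
      new k = (n₁ ℕ.+ n₂) ↑ʳ k

      V₁ : Fin n₁ → Fin (n₁ ℕ.+ n₂)
      V₁ i = i ↑ˡ n₂

      V₂ : Fin n₂ → Fin (n₁ ℕ.+ n₂)
      V₂ k = n₁ ↑ʳ k

      numbering-V₁ : ∀ i → numbering n₁ n₂ (old (V₁ i)) ≡ inj₁ (inj₁ i)
      numbering-V₁ i = ≡.trans (cong (map₁ (splitAt n₁)) (Fin.splitAt-↑ˡ (n₁ ℕ.+ n₂) (V₁ i) n₁))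
        (cong inj₁ (Fin.splitAt-↑ˡ n₁ i n₂))

      numbering-V₂ : ∀ k → numbering n₁ n₂ (old (V₂ k)) ≡ inj₁ (inj₂ k)
      numbering-V₂ k = ≡.trans (cong (map₁ (splitAt n₁)) (Fin.splitAt-↑ˡ (n₁ ℕ.+ n₂) (V₂ k) n₁))
        (cong inj₁ (Fin.splitAt-↑ʳ n₁ n₂ k))

      numbering-new : ∀ k → numbering n₁ n₂ (new k) ≡ inj₂ k
      numbering-new k = cong (map₁ (splitAt n₁)) (Fin.splitAt-↑ʳ (n₁ ℕ.+ n₂) n₁ k)

      entry : ∀ {a b v w d} → numbering n₁ n₂ a ≡ v → numbering n₁ n₂ b ≡ w →
              Iᴹ ((n₁ ℕ.+ n₂) ℕ.+ n₁) a b ≡ d →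
              P a b ≈ x * d - (if does (adj? Γ v w) then 1# else 0#)
      entry a≡v b≡w I≡d = reflexive (≡.trans (charMatrix-pullback (numbering n₁ n₂) Γ x a≡v b≡w)
        (cong (λ d → x * d - _) I≡d))

      offDiagonal : ∀ {y} a → y ≈ x * 0# - a → y ≈ - a
      offDiagonal a y≈ = trans y≈ (trans (+-congʳ (zeroʳ x)) (+-identityˡ _))

      Iᴹ-old : ∀ a b → Iᴹ ((n₁ ℕ.+ n₂) ℕ.+ n₁) (old a) (old b) ≡ Iᴹ (n₁ ℕ.+ n₂) a b
      Iᴹ-old = Iᴹ-↑ˡ-↑ˡ n₁

      -- The nine blocks of the characteristic matrix; indices 1, 2, 3 stand for V(G₁), V(G₂) and
      -- the new vertices.

      P₁₁ : ∀ i j → P (old (V₁ i)) (old (V₁ j)) ≈ charMatrix x A₁ i j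
      P₁₁ i j = entry (numbering-V₁ i) (numbering-V₁ j)
        (≡.trans (Iᴹ-old (V₁ i) (V₁ j)) (Iᴹ-↑ˡ-↑ˡ n₂ i j))

      P₁₂ : ∀ i l → P (old (V₁ i)) (old (V₂ l)) ≈ - 1#
      P₁₂ i l = offDiagonal 1# (entry (numbering-V₁ i) (numbering-V₂ l)
        (≡.trans (Iᴹ-old (V₁ i) (V₂ l)) (Iᴹ-↑ˡ-↑ʳ i l)))

      P₂₁ : ∀ k j → P (old (V₂ k)) (old (V₁ j)) ≈ - 1#
      P₂₁ k j = offDiagonal 1# (entry (numbering-V₂ k) (numbering-V₁ j)
        (≡.trans (Iᴹ-old (V₂ k) (V₁ j)) (Iᴹ-↑ʳ-↑ˡ k j)))

      P₂₂ : ∀ k l → P (old (V₂ k)) (old (V₂ l)) ≈ charMatrix x A₂ k l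
      P₂₂ k l = entry (numbering-V₂ k) (numbering-V₂ l)
        (≡.trans (Iᴹ-old (V₂ k) (V₂ l)) (Iᴹ-↑ʳ-↑ʳ n₁ k l))

      P₁₃ : ∀ i k → P (old (V₁ i)) (new k) ≈ - B k i
      P₁₃ i k = offDiagonal (B k i)
        (entry (numbering-V₁ i) (numbering-new k) (Iᴹ-↑ˡ-↑ʳ (V₁ i) k))

      P₃₁ : ∀ k j → P (new k) (old (V₁ j)) ≈ - B k j
      P₃₁ k j = offDiagonal (B k j)
        (entry (numbering-new k) (numbering-V₁ j) (Iᴹ-↑ʳ-↑ˡ k (V₁ j)))

      P₂₃ : ∀ l k → P (old (V₂ l)) (new k) ≈ 0#
      P₂₃ l k = trans (offDiagonal 0#
        (entry (numbering-V₂ l) (numbering-new k) (Iᴹ-↑ˡ-↑ʳ (V₂ l) k))) -0#≈0#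

      P₃₂ : ∀ k l → P (new k) (old (V₂ l)) ≈ 0#
      P₃₂ k l = trans (offDiagonal 0#
        (entry (numbering-new k) (numbering-V₂ l) (Iᴹ-↑ʳ-↑ˡ k (V₂ l)))) -0#≈0#

      P₃₃ : ∀ k l → P (new k) (new l) ≈ x * Iᴹ n₁ k l
      P₃₃ k l = trans (entry (numbering-new k) (numbering-new l) (Iᴹ-↑ʳ-↑ʳ (n₁ ℕ.+ n₂) k l))
        (trans (+-congˡ -0#≈0#) (+-identityʳ _))

      -- The block of the new vertices is xI with inverse tI, so adding this term to the old block
      -- gives its Schur complement `Q`.
      correction : Matrix (n₁ ℕ.+ n₂) (n₁ ℕ.+ n₂)
      correction a b = ∑[ k < n₁ ] (- (t * P (old a) (new k)) * P (new k) (old b))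

      Q : Matrix (n₁ ℕ.+ n₂) (n₁ ℕ.+ n₂)
      Q a b = P (old a) (old b) + correction a b

      det-P : det P ≈ det Q * x ^ n₁
      det-P = trans
        (det-schur (n₁ ℕ.+ n₂) P (λ a k → - (t * P (old a) (new k))) eliminated)
        (*-congˡ (trans (det-cong P₃₃) (det-scalar n₁ x)))
        where
        eliminated : ∀ a l → P (old a) (new l) +
          ∑[ k < n₁ ] (- (t * P (old a) (new k)) * P (new k) (new l)) ≈ 0#
        eliminated a l = trans (+-congˡ (begin
          ∑[ k < n₁ ] (- (t * P (old a) (new k)) * P (new k) (new l))
            ≈⟨ sum-cong-≋ (λ k → begin
                 - (t * P (old a) (new k)) * P (new k) (new l)
                   ≈⟨ *-cong (-‿distribʳ-* t _) (P₃₃ k l) ⟩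
                 t * - P (old a) (new k) * (x * Iᴹ n₁ k l)
                   ≈⟨ solve 4 (λ x t p d → t ⊗ p ⊗ (x ⊗ d) ⊜ x ⊗ t ⊗ (p ⊗ d)) refl
                        x t (- P (old a) (new k)) (Iᴹ n₁ k l) ⟩
                 x * t * (- P (old a) (new k) * Iᴹ n₁ k l)
                   ≈⟨ trans (*-congʳ x*t≈1) (*-identityˡ _) ⟩
                 - P (old a) (new k) * Iᴹ n₁ k l ∎) ⟩
          ∑[ k < n₁ ] (- P (old a) (new k) * Iᴹ n₁ k l)
            ≈⟨ sum-*-Iᴹ (λ k → - P (old a) (new k)) l ⟩
          - P (old a) (new l) ∎)) (-‿inverseʳ _)

      X : Matrix n₁ n₁
      X = x ·ᴹ Iᴹ n₁ -ᴹ A₁ -ᴹ t ·ᴹ (B *ᴹ B)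

      Q₁₁ : ∀ i j → Q (V₁ i) (V₁ j) ≈ X i j
      Q₁₁ i j = +-cong (P₁₁ i j) (begin
        correction (V₁ i) (V₁ j)
          ≈⟨ sum-cong-≋ (λ k → begin
               - (t * P (old (V₁ i)) (new k)) * P (new k) (old (V₁ j))
                 ≈⟨ *-cong (trans (-‿distribʳ-* t _) (*-congˡ (trans (-‿cong (P₁₃ i k)) (-‿involutive _))))
                           (P₃₁ k j) ⟩
               t * B k i * - B k j
                 -- Both factors are indexed from the new vertex k, which gives BᵀB; the symmetry of
                 -- `H` turns it into B².
                 ≡⟨ cong (λ b → t * b * - B k j) (adjacency-sym H k i) ⟩
               t * B i k * - B k j
                 ≈⟨ trans (sym (-‿distribʳ-* _ _)) (trans (-‿cong (*-assoc t _ _)) (-‿distribˡ-* t _)) ⟩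
               - t * (B i k * B k j) ∎) ⟩
        ∑[ k < n₁ ] (- t * (B i k * B k j))
          ≈⟨ *-distribˡ-sum (- t) (λ k → B i k * B k j) ⟨
        - t * (B *ᴹ B) i j
          ≈⟨ -‿distribˡ-* t _ ⟨
        - (t * (B *ᴹ B) i j) ∎)

      correction-₂ : ∀ a l → correction a (V₂ l) ≈ 0#
      correction-₂ a l = sum-≈0 λ k → trans (*-congˡ (P₃₂ k l)) (zeroʳ _)

      correction₂- : ∀ k b → correction (V₂ k) b ≈ 0#
      correction₂- k b = sum-≈0 λ l → trans
        (*-congʳ (trans (-‿cong (trans (*-congˡ (P₂₃ k l)) (zeroʳ t))) -0#≈0#)) (zeroˡ _)

      Q₁₂ : ∀ i l → Q (V₁ i) (V₂ l) ≈ - 1#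
      Q₁₂ i l = trans (+-cong (P₁₂ i l) (correction-₂ (V₁ i) l)) (+-identityʳ _)

      Q₂₁ : ∀ k j → Q (V₂ k) (V₁ j) ≈ - 1#
      Q₂₁ k j = trans (+-cong (P₂₁ k j) (correction₂- k (V₁ j))) (+-identityʳ _)

      Q₂₂ : ∀ k l → Q (V₂ k) (V₂ l) ≈ charMatrix x A₂ k l
      Q₂₂ k l = trans (+-cong (P₂₂ k l) (correction-₂ (V₂ k) l)) (+-identityʳ _)

    charPoly-splittingJoin :
      (I₂ : Inverse (charMatrix x A₂)) (I₁ : Inverse (charMatrix x (A₁ +ᴹ t ·ᴹ (B *ᴹ B)))) →
      charPoly x (adjacency (pullback (numbering n₁ n₂) Γ)) ≈
        x ^ n₁ * charPoly x A₂
          * det (x ·ᴹ Iᴹ n₁ -ᴹ A₁ -ᴹ t ·ᴹ (B *ᴹ B))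
          * (1# - coronal x A₂ I₂ * coronal x (A₁ +ᴹ t ·ᴹ (B *ᴹ B)) I₁)
    charPoly-splittingJoin I₂ I₁ = begin
      det P
        ≈⟨ det-P ⟩
      det Q * x ^ n₁
        -- `Q₁₂` is -J, so one combination of the rows of V(G₂), with coefficients s₂ = 𝟙ᵀ (xI -
        -- A₂)⁻¹, clears each of its rows.
        ≈⟨ *-congʳ (det-schur n₁ Q (λ _ → s₂) λ i l → begin
             Q (V₁ i) (V₂ l) + ∑[ k < n₂ ] (s₂ k * Q (V₂ k) (V₂ l))
               ≈⟨ +-cong (Q₁₂ i l) (trans (sum-cong-≋ λ k → *-congˡ (Q₂₂ k l)) (columnSums-inverse I₂ l)) ⟩
             - 1# + 1#
               ≈⟨ -‿inverseˡ 1# ⟩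
             0# ∎) ⟩
      det (λ i j → Q (V₁ i) (V₁ j) + ∑[ k < n₂ ] (s₂ k * Q (V₂ k) (V₁ j))) *
      det (λ k l → Q (V₂ k) (V₂ l)) * x ^ n₁
        ≈⟨ *-congʳ (*-cong (det-cong λ i j → +-cong (Q₁₁ i j) (rank-one j)) (det-cong Q₂₂)) ⟩
      det (λ i j → X i j - Γ₂ * 1#) * charPoly x A₂ * x ^ n₁
        -- Γ₂ J is the product of the constant column Γ₂ and the row of ones, and `s₁` is 𝟙ᵀ X⁻¹.
        ≈⟨ *-congʳ (*-congʳ (det-rankOne X (λ _ → 1#) (λ _ → Γ₂) s₁ s₁X≈1)) ⟩
      (1# - ∑[ k < n₁ ] (s₁ k * Γ₂)) * det X * charPoly x A₂ * x ^ n₁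
        ≈⟨ *-congʳ (*-congʳ (*-congʳ (+-congˡ (-‿cong (begin
             ∑[ k < n₁ ] (s₁ k * Γ₂)          ≈⟨ *-distribʳ-sum Γ₂ s₁ ⟨
             sum s₁ * Γ₂                      ≈⟨ *-congʳ (sum-cong-≋ λ k → *-identityʳ (s₁ k)) ⟨
             Γ₁ * Γ₂                          ≈⟨ *-comm Γ₁ Γ₂ ⟩
             Γ₂ * Γ₁                          ∎))))) ⟩
      (1# - Γ₂ * Γ₁) * det X * charPoly x A₂ * x ^ n₁
        ≈⟨ solve 4 (λ a b c d → a ⊗ b ⊗ c ⊗ d ⊜ d ⊗ c ⊗ b ⊗ a) refl
             (1# - Γ₂ * Γ₁) (det X) (charPoly x A₂) (x ^ n₁) ⟩
      x ^ n₁ * charPoly x A₂ * det X * (1# - Γ₂ * Γ₁) ∎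
      where
      Γ₂ = coronal x A₂ I₂
      Γ₁ = coronal x (A₁ +ᴹ t ·ᴹ (B *ᴹ B)) I₁

      s₂ : Vector Carrier n₂
      s₂ = (𝟙ᵀ n₂ *ᴹ inv I₂) zero

      s₁ : Vector Carrier n₁
      s₁ = (𝟙ᵀ n₁ *ᴹ inv I₁) zero

      rank-one : ∀ j → ∑[ k < n₂ ] (s₂ k * Q (V₂ k) (V₁ j)) ≈ - (Γ₂ * 1#)
      rank-one j = begin
        ∑[ k < n₂ ] (s₂ k * Q (V₂ k) (V₁ j))
          ≈⟨ sum-cong-≋ (λ k → begin
               s₂ k * Q (V₂ k) (V₁ j)    ≈⟨ *-congˡ (Q₂₁ k j) ⟩
               s₂ k * - 1#               ≈⟨ *-congʳ (*-identityʳ (s₂ k)) ⟨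
               s₂ k * 1# * - 1#          ∎) ⟩
        ∑[ k < n₂ ] (s₂ k * 1# * - 1#)
          ≈⟨ *-distribʳ-sum (- 1#) (λ k → s₂ k * 1#) ⟨
        Γ₂ * - 1#
          ≈⟨ -‿distribʳ-* Γ₂ 1# ⟨
        - (Γ₂ * 1#) ∎

      s₁X≈1 : ∀ j → ∑[ k < n₁ ] (s₁ k * X k j) ≈ 1#
      s₁X≈1 j = trans
        (sum-cong-≋ {x = λ k → s₁ k * X k j} {λ k → s₁ k * charMatrix x (A₁ +ᴹ t ·ᴹ (B *ᴹ B)) k j} λ k →
          -- `X` subtracts A₁ and t B² one after the other, while `I₁` inverts the matrix from which
          -- their sum is subtracted.
          *-congˡ (trans (+-assoc _ _ _) (+-congˡ (⁻¹-∙-comm _ _))))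
        (columnSums-inverse I₁ j)

  -- Scaled adjacency matrices have entries in 𝔪.

  module _ {p} {𝔪 : Pred Carrier p} (quasiRegular : QuasiRegular 𝔪) {t} (t∈ : 𝔪 t) where

    open QuasiRegular quasiRegular

    adjacency-closed : ∀ {n} (G : Graph (Fin n)) i j → 𝔪 (t * adjacency G i j)
    adjacency-closed G i j with does (adj? G i j)
    ... | true  = resp (sym (*-identityʳ t)) t∈
    ... | false = resp (sym (zeroʳ t)) 0∈

    -- The factor t² is shared out as (t B)(t B), so that every summand is a product of two elements
    -- of 𝔪.
    adjacency+square-closed : ∀ {n} (G H : Graph (Fin n)) i j →
      𝔪 (t * (adjacency G +ᴹ t ·ᴹ (adjacency H *ᴹ adjacency H)) i j)
    adjacency+square-closed {n} G H i j = resp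
      (begin
        t * A i j + ∑[ k < n ] (t * B i k * (t * B k j))
          ≈⟨ +-congˡ (sum-cong-≋ λ k →
               solve 3 (λ t a b → t ⊗ a ⊗ (t ⊗ b) ⊜ t ⊗ t ⊗ (a ⊗ b)) refl t (B i k) (B k j)) ⟩
        t * A i j + ∑[ k < n ] (t * t * (B i k * B k j))
          ≈⟨ +-congˡ (*-distribˡ-sum (t * t) (λ k → B i k * B k j)) ⟨
        t * A i j + t * t * (B *ᴹ B) i j
          ≈⟨ +-congˡ (*-assoc t t _) ⟩
        t * A i j + t * (t * (B *ᴹ B) i j)
          ≈⟨ distribˡ t _ _ ⟨
        t * (A i j + t * (B *ᴹ B) i j) ∎)
      (+-closed (adjacency-closed G i j)
        (sum-closed (λ k → t * B i k * (t * B k j)) λ k →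
          *-closed (adjacency-closed H i k) (adjacency-closed H k j)))
      where
      A = adjacency G
      B = adjacency H

-- Quasi-regularity of proper fractions, over an abstract integral domain.

module ProperFractions {c ℓ} (D : CommutativeRing c ℓ) where

  open CommutativeRing D

  -- W p w is meant to say that p / w is a proper fraction with w monic.
  module Proper
    (1≉0 : ¬ 1# ≈ 0#) (noZeroDivisors : ∀ a b → a * b ≈ 0# → a ≈ 0# ⊎ b ≈ 0#)
    {w} (W : Carrier → Carrier → Set w)
    (W⇒≉0 : ∀ {p w} → W p w → ¬ w ≈ 0#)
    (W-0 : W 0# 1#)
    (W-+ : ∀ {p w p′ w′} → W p w → W p′ w′ → W (p * w′ + p′ * w) (w * w′))
    (W-* : ∀ {p w p′ w′} → W p w → W p′ w′ → W (p * p′) (w * w′))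
    (W-∸ : ∀ {p w} → W p w → W p (w - p))
    where

    open Fractions D 1≉0 noZeroDivisors
    open MatrixAlgebra fractionField using (QuasiRegular)
    open Relation.Binary.Reasoning.Setoid setoid
    open Algebra.Solver.Ring.NaturalCoefficients.Default commutativeSemiring
      using (solve) renaming (_:=_ to _⊜_; _:+_ to _⊕_; _:*_ to _⊗_)

    -- Only some representative p / w has to be admissible, not `num m` over `den m` itself; this
    -- makes membership invariant under `_≃_`.
    record Proper (m : Fraction) : Set (c ⊔ ℓ ⊔ w) where
      constructor proper
      field
        {top bottom} : Carrier
        admissible   : W top bottom
        equation     : num m * bottom ≈ top * den m

    proper-quasiRegular : QuasiRegular Proper
    proper-quasiRegular = record
      { resp         = resp
      ; 0∈           = proper W-0 refl
      ; +-closed     = +-closed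
      ; *-closed     = *-closed
      ; quasiInverse = quasiInverse
      }
      where
      resp : ∀ {m n} → m ≃ n → Proper m → Proper n
      resp {frac a b b≉0} {frac a′ b′ _} (mk≃ ab′≈a′b) (proper {p} {w} Wpw aw≈pb) =
        proper Wpw (*-cancelʳ b≉0 (begin
          a′ * w * b      ≈⟨ solve 3 (λ a′ w b → a′ ⊗ w ⊗ b ⊜ a′ ⊗ b ⊗ w) refl a′ w b ⟩
          a′ * b * w      ≈⟨ *-congʳ ab′≈a′b ⟨
          a * b′ * w      ≈⟨ solve 3 (λ a b′ w → a ⊗ b′ ⊗ w ⊜ a ⊗ w ⊗ b′) refl a b′ w ⟩
          a * w * b′      ≈⟨ *-congʳ aw≈pb ⟩
          p * b * b′      ≈⟨ solve 3 (λ p b b′ → p ⊗ b ⊗ b′ ⊜ p ⊗ b′ ⊗ b) refl p b b′ ⟩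
          p * b′ * b      ∎))

      +-closed : ∀ {m n} → Proper m → Proper n → Proper (m ⊞ n)
      +-closed {frac a b _} {frac a′ b′ _} (proper {p} {w} Wpw aw≈pb) (proper {p′} {w′} Wpw′ aw≈pb′) =
        proper (W-+ Wpw Wpw′) (begin
          (a * b′ + a′ * b) * (w * w′)
            ≈⟨ solve 6 (λ a b w a′ b′ w′ → (a ⊗ b′ ⊕ a′ ⊗ b) ⊗ (w ⊗ w′) ⊜
                 a ⊗ w ⊗ (b′ ⊗ w′) ⊕ a′ ⊗ w′ ⊗ (b ⊗ w)) refl a b w a′ b′ w′ ⟩
          a * w * (b′ * w′) + a′ * w′ * (b * w)
            ≈⟨ +-cong (*-congʳ aw≈pb) (*-congʳ aw≈pb′) ⟩
          p * b * (b′ * w′) + p′ * b′ * (b * w)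
            ≈⟨ solve 6 (λ p b w p′ b′ w′ → p ⊗ b ⊗ (b′ ⊗ w′) ⊕ p′ ⊗ b′ ⊗ (b ⊗ w) ⊜
                 (p ⊗ w′ ⊕ p′ ⊗ w) ⊗ (b ⊗ b′)) refl p b w p′ b′ w′ ⟩
          (p * w′ + p′ * w) * (b * b′) ∎)

      *-closed : ∀ {m n} → Proper m → Proper n → Proper (m ⊠ n)
      *-closed {frac a b _} {frac a′ b′ _} (proper {p} {w} Wpw aw≈pb) (proper {p′} {w′} Wpw′ aw≈pb′) =
        proper (W-* Wpw Wpw′) (begin
          a * a′ * (w * w′)
            ≈⟨ solve 4 (λ a a′ w w′ → a ⊗ a′ ⊗ (w ⊗ w′) ⊜ a ⊗ w ⊗ (a′ ⊗ w′)) refl a a′ w w′ ⟩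
          a * w * (a′ * w′)
            ≈⟨ *-cong aw≈pb aw≈pb′ ⟩
          p * b * (p′ * b′)
            ≈⟨ solve 4 (λ p b p′ b′ → p ⊗ b ⊗ (p′ ⊗ b′) ⊜ p ⊗ p′ ⊗ (b ⊗ b′)) refl p b p′ b′ ⟩
          p * p′ * (b * b′) ∎)

      quasiInverse : ∀ {m} → Proper m → ∃[ n ] Proper n × n ≃ m ⊞ m ⊠ n
      quasiInverse {frac a b _} (proper {p} {w} Wpw aw≈pb) =
        -- With m = p / w, 1 / (1 - m) = w / (w - p) = 1 + p / (w - p), whence the quasi-inverse p /
        -- (w - p).
        frac p v (W⇒≉0 Wpv) , proper Wpv refl , mk≃ (begin
          p * (b * (b * v))
            ≈⟨ solve 3 (λ p b v → p ⊗ (b ⊗ (b ⊗ v)) ⊜ p ⊗ b ⊗ (b ⊗ v)) refl p b v ⟩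
          p * b * (b * v)
            ≈⟨ *-congʳ aw≈pb ⟨
          a * w * (b * v)
            ≈⟨ *-congʳ (*-congˡ (trans (trans (sym (+-identityʳ w)) (+-congˡ (sym (-‿inverseˡ p))))
                 (sym (+-assoc w (- p) p)))) ⟩
          a * (v + p) * (b * v)
            ≈⟨ solve 4 (λ a b p v → a ⊗ (v ⊕ p) ⊗ (b ⊗ v) ⊜ (a ⊗ (b ⊗ v) ⊕ a ⊗ p ⊗ b) ⊗ v)
                 refl a b p v ⟩
          (a * (b * v) + a * p * b) * v ∎)
        where
        v   = w - p
        Wpv = W-∸ Wpw

-- Degrees, monic polynomials and proper rational functions over ℚ.

module ProperRationalFunctions where

  open List using ([]; _∷_; length)
  open PolyProperties

  infix 8 xₚ^_

  -- Shifting the list, rather than iterating `_*ₚ_`, makes the leading coefficient computable by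
  -- structural recursion.
  xₚ^_ : ℕ → Poly
  xₚ^ zero  = 1ₚ
  xₚ^ suc d = 0ℚ ∷ xₚ^ d

  xₚ^-+ : ∀ d e → xₚ^ d *ₚ xₚ^ e ≈ₚ xₚ^ (d ℕ.+ e)
  xₚ^-+ zero    e = *-identityˡ (xₚ^ e)
  xₚ^-+ (suc d) e = ≈-trans (0∷-* (xₚ^ d) (xₚ^ e)) (∷-cong ≡.refl (xₚ^-+ d e))

  coeff-xₚ^ : ∀ d → coeff (xₚ^ d) d ≡ 1ℚ
  coeff-xₚ^ zero    = ≡.refl
  coeff-xₚ^ (suc d) = coeff-xₚ^ d

  coeff-length : ∀ p {n} → length p ≤ n → coeff p n ≡ 0ℚ
  coeff-length []      _         = ≡.refl
  coeff-length (a ∷ p) (s≤s p≤n) = coeff-length p p≤n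

  length-+ : ∀ p q {d} → length p ≤ d → length q ≤ d → length (p +ₚ q) ≤ d
  length-+ []      q       p≤d       q≤d       = q≤d
  length-+ (a ∷ p) []      p≤d       q≤d       = p≤d
  length-+ (a ∷ p) (b ∷ q) (s≤s p≤d) (s≤s q≤d) = s≤s (length-+ p q p≤d q≤d)

  length-* : ∀ p q → length (p *ₚ q) ≤ length p ℕ.+ length q
  length-* []      q = z≤n
  length-* (a ∷ p) q = length-+ (a ·ₚ q) (0ℚ ∷ p *ₚ q)
    (ℕ.≤-trans (ℕ.≤-reflexive (length-map (a ℚ.*_) q)) (ℕ.m≤n+m (length q) (suc (length p))))
    (s≤s (length-* p q))

  -- Trailing zeros make the length of a list vary within a class of `_≈ₚ_`, so the bound is put on
  -- some representative. The bound 0 leaves only the zero polynomial.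
  record Degree< (d : ℕ) (p : Poly) : Set where
    constructor degree<
    field
      {representative} : Poly
      equal            : p ≈ₚ representative
      bound            : length representative ≤ d

  degree<-resp : ∀ {d p q} → p ≈ₚ q → Degree< d p → Degree< d q
  degree<-resp p≈q (degree< p≈r r≤d) = degree< (≈-trans (≈-sym p≈q) p≈r) r≤d

  degree<-+ : ∀ {d p q} → Degree< d p → Degree< d q → Degree< d (p +ₚ q)
  degree<-+ (degree< {r} p≈r r≤d) (degree< {s} q≈s s≤d) =
    degree< (+-cong p≈r q≈s) (length-+ r s r≤d s≤d)

  degree<-neg : ∀ {d p} → Degree< d p → Degree< d (-ₚ p)
  degree<-neg (degree< {r} p≈r r≤d) =
    degree< (neg-cong p≈r) (ℕ.≤-trans (ℕ.≤-reflexive (length-map (λ a → ℚ.- a) r)) r≤d)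

  degree<-* : ∀ {d e p q} → Degree< d p → Degree< e q → Degree< (d ℕ.+ e) (p *ₚ q)
  degree<-* (degree< {r} p≈r r≤d) (degree< {s} q≈s s≤e) =
    degree< (*-cong p≈r q≈s) (ℕ.≤-trans (length-* r s) (ℕ.+-mono-≤ r≤d s≤e))

  -- The list for x^d has length d + 1, so `degree<-*` would lose one here. Counting shifts gives
  -- the sharp bound on which products with monic polynomials depend.
  degree<-xₚ^* : ∀ d {e p} → Degree< e p → Degree< (d ℕ.+ e) (xₚ^ d *ₚ p)
  degree<-xₚ^* zero    {p = p} p<e = degree<-resp (≈-sym (*-identityˡ p)) p<e
  degree<-xₚ^* (suc d) {p = p} p<e with degree<-xₚ^* d p<e
  ... | degree< eq r≤ = degree< (≈-trans (0∷-* (xₚ^ d) p) (∷-cong ≡.refl eq)) (s≤s r≤)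

  coeff-degree< : ∀ {d p} → Degree< d p → coeff p d ≡ 0ℚ
  coeff-degree< {d} (degree< {r} p≈r r≤d) = ≡.trans (coeff≡ p≈r d) (coeff-length r r≤d)

  record Monic (d : ℕ) (w : Poly) : Set where
    constructor monic
    field
      {lower}       : Poly
      lower<        : Degree< d lower
      decomposition : w ≈ₚ xₚ^ d +ₚ lower

  monic⇒≉0 : ∀ {d w} → Monic d w → ¬ w ≈ₚ 0ₚ
  monic⇒≉0 {d} {w} (monic {q} q<d w≈) w≈0 = ℚ.1≢0 (begin
    1ℚ                                ≡⟨ ℚ.+-identityʳ 1ℚ ⟨
    1ℚ ℚ.+ 0ℚ                         ≡⟨ ≡.cong₂ ℚ._+_ (coeff-xₚ^ d) (coeff-degree< q<d) ⟨
    coeff (xₚ^ d) d ℚ.+ coeff q d     ≡⟨ coeff-+ (xₚ^ d) q d ⟨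
    coeff (xₚ^ d +ₚ q) d              ≡⟨ coeff≡ w≈ d ⟨
    coeff w d                         ≡⟨ coeff≡ w≈0 d ⟩
    0ℚ                                ∎)
    where open ≡.≡-Reasoning

  degree<-*-monic : ∀ {d e p w} → Degree< d p → Monic e w → Degree< (d ℕ.+ e) (p *ₚ w)
  degree<-*-monic {d} {e} {p} {w} p<d (monic {q} q<e w≈) = degree<-resp
    (begin
      xₚ^ e *ₚ p +ₚ p *ₚ q     ≈⟨ +-cong (*-comm (xₚ^ e) p) ≈-refl ⟩
      p *ₚ xₚ^ e +ₚ p *ₚ q     ≈⟨ *-distribˡ p (xₚ^ e) q ⟨
      p *ₚ (xₚ^ e +ₚ q)        ≈⟨ *-congʳ p w≈ ⟨
      p *ₚ w                   ∎)
    (degree<-+ (≡.subst (λ f → Degree< f (xₚ^ e *ₚ p)) (ℕ.+-comm e d) (degree<-xₚ^* e p<d))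
               (degree<-* p<d q<e))
    where open Relation.Binary.Reasoning.Setoid (CommutativeRing.setoid ℚ[x])

  monic-* : ∀ {d e w w′} → Monic d w → Monic e w′ → Monic (d ℕ.+ e) (w *ₚ w′)
  monic-* {d} {e} {w} {w′} (monic {q} q<d w≈) w′-monic@(monic {q′} q′<e w′≈) = monic
    (degree<-+ (degree<-xₚ^* d q′<e) (degree<-*-monic q<d w′-monic))
    (begin
      w *ₚ w′
        ≈⟨ *-cong w≈ ≈-refl ⟩
      (xₚ^ d +ₚ q) *ₚ w′
        ≈⟨ *-distribʳ w′ (xₚ^ d) q ⟩
      xₚ^ d *ₚ w′ +ₚ q *ₚ w′
        ≈⟨ +-cong (≈-trans (*-congʳ (xₚ^ d) w′≈) (*-distribˡ (xₚ^ d) (xₚ^ e) q′)) ≈-refl ⟩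
      (xₚ^ d *ₚ xₚ^ e +ₚ xₚ^ d *ₚ q′) +ₚ q *ₚ w′
        ≈⟨ +-assoc (xₚ^ d *ₚ xₚ^ e) (xₚ^ d *ₚ q′) (q *ₚ w′) ⟩
      xₚ^ d *ₚ xₚ^ e +ₚ (xₚ^ d *ₚ q′ +ₚ q *ₚ w′)
        ≈⟨ +-cong (xₚ^-+ d e) ≈-refl ⟩
      xₚ^ (d ℕ.+ e) +ₚ (xₚ^ d *ₚ q′ +ₚ q *ₚ w′) ∎)
    where open Relation.Binary.Reasoning.Setoid (CommutativeRing.setoid ℚ[x])

  record MonicFraction (p w : Poly) : Set where
    constructor monicFraction
    field
      {degree}     : ℕ
      top<         : Degree< degree p
      bottom-monic : Monic degree w

  monicFraction⇒≉0 : ∀ {p w} → MonicFraction p w → ¬ w ≈ₚ 0ₚ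
  monicFraction⇒≉0 (monicFraction _ w-monic) = monic⇒≉0 w-monic

  monicFraction-0 : MonicFraction 0ₚ 1ₚ
  monicFraction-0 = monicFraction (degree< ≈-refl z≤n) (monic {0} {lower = []} (degree< ≈-refl z≤n) ≈-refl)

  monicFraction-+ : ∀ {p w p′ w′} → MonicFraction p w → MonicFraction p′ w′ →
                    MonicFraction (p *ₚ w′ +ₚ p′ *ₚ w) (w *ₚ w′)
  monicFraction-+ {p} {w} {p′} {w′} (monicFraction {d} p<d w-monic) (monicFraction {e} p′<e w′-monic) =
    monicFraction
      (degree<-+ (degree<-*-monic p<d w′-monic)
        (≡.subst (λ f → Degree< f (p′ *ₚ w)) (ℕ.+-comm e d) (degree<-*-monic p′<e w-monic)))
      (monic-* w-monic w′-monic)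

  monicFraction-* : ∀ {p w p′ w′} → MonicFraction p w → MonicFraction p′ w′ →
                    MonicFraction (p *ₚ p′) (w *ₚ w′)
  monicFraction-* (monicFraction p<d w-monic) (monicFraction p′<e w′-monic) =
    monicFraction (degree<-* p<d p′<e) (monic-* w-monic w′-monic)

  -- Since p has smaller degree than w, subtracting it leaves the leading term alone. This is the
  -- step that makes 1 - p / w a unit.
  monicFraction-∸ : ∀ {p w} → MonicFraction p w → MonicFraction p (w +ₚ (-ₚ p))
  monicFraction-∸ {p} (monicFraction {d} p<d (monic {q} q<d w≈)) = monicFraction p<d
    (monic (degree<-+ q<d (degree<-neg p<d))
      (≈-trans (+-cong w≈ ≈-refl) (+-assoc (xₚ^ d) q (-ₚ p))))

  open ProperFractions.Proper ℚ[x] 1≉0 noZeroDivisors MonicFraction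
    monicFraction⇒≉0 monicFraction-0 monicFraction-+ monicFraction-* monicFraction-∸ public

  proper-1/𝑥 : Proper 1/𝑥
  proper-1/𝑥 = proper {top = 1ₚ} {xₚ}
    (monicFraction (degree< ≈-refl (s≤s z≤n)) (monic {1} {lower = []} (degree< ≈-refl z≤n) ≈-refl))
    ≈-refl

-- The two identities over ℚ(x).

open import Defs

theorem4p1 : ∀ (n₁ n₂ : ℕ) (G₁ : Graph (Fin n₁)) (G₂ : Graph (Fin n₂)) →
  let A₁ = adjacency G₁
      A₂ = adjacency G₂
      Ā₁ = adjacency (complement G₁)
      M  = A₁ +ᴹ 1/𝑥 ·ᴹ (Ā₁ *ᴹ Ā₁)
      N  = A₁ +ᴹ 1/𝑥 ·ᴹ (A₁ *ᴹ A₁)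
  in
  Inverse (charMatrix 𝑥 A₂) ×
  Inverse (charMatrix 𝑥 M) ×
  Inverse (charMatrix 𝑥 N) ×
  ((I₂ : Inverse (charMatrix 𝑥 A₂)) (I₁ : Inverse (charMatrix 𝑥 M)) →
    charPoly 𝑥 (adjacency (NNSJoin G₁ G₂)) ≈ᶠ
      𝑥 ^ᶠ n₁ *ᶠ charPoly 𝑥 A₂
        *ᶠ det (𝑥 ·ᴹ Iᴹ n₁ -ᴹ A₁ -ᴹ 1/𝑥 ·ᴹ (Ā₁ *ᴹ Ā₁))
        *ᶠ (1ᶠ -ᶠ coronal 𝑥 A₂ I₂ *ᶠ coronal 𝑥 M I₁)) ×
  ((I₂ : Inverse (charMatrix 𝑥 A₂)) (I₁ : Inverse (charMatrix 𝑥 N)) →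
    charPoly 𝑥 (adjacency (NSJoin G₁ G₂)) ≈ᶠ
      𝑥 ^ᶠ n₁ *ᶠ charPoly 𝑥 A₂
        *ᶠ det (𝑥 ·ᴹ Iᴹ n₁ -ᴹ A₁ -ᴹ 1/𝑥 ·ᴹ (A₁ *ᴹ A₁))
        *ᶠ (1ᶠ -ᶠ coronal 𝑥 A₂ I₂ *ᶠ coronal 𝑥 N I₁))
theorem4p1 n₁ n₂ G₁ G₂ =
  invertible A₂ (adjacency-closed proper-quasiRegular proper-1/𝑥 G₂) ,
  invertible (A₁ +ᴹ 1/𝑥 ·ᴹ (Ā₁ *ᴹ Ā₁))
    (adjacency+square-closed proper-quasiRegular proper-1/𝑥 G₁ (complement G₁)) ,
  invertible (A₁ +ᴹ 1/𝑥 ·ᴹ (A₁ *ᴹ A₁))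
    (adjacency+square-closed proper-quasiRegular proper-1/𝑥 G₁ G₁) ,
  -- The relation defining `NNSJoin` is by definition the adjacency of the complement, so both joins
  -- are instances of one statement, with H the complement here and G₁ below.
  charPoly-splittingJoin G₁ G₂ (complement G₁) {𝑥} {1/𝑥} 𝑥*1/𝑥≈1 ,
  charPoly-splittingJoin G₁ G₂ G₁ {𝑥} {1/𝑥} 𝑥*1/𝑥≈1
  where
  open MatrixAlgebra ℚ⟨x⟩
  open SplittingJoins ℚ⟨x⟩
  open ProperRationalFunctions

  A₁ = adjacency G₁
  A₂ = adjacency G₂
  Ā₁ = adjacency (complement G₁)

  invertible : ∀ {n} (M : Matrix n n) → (∀ i j → Proper (1/𝑥 *ᶠ M i j)) →
               Inverse (charMatrix 𝑥 M)
  invertible = charMatrix-inverse proper-quasiRegular {𝑥} {1/𝑥} 𝑥*1/𝑥≈1
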